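{- For any given weighted rooted tree $L$, the proportion of weighted (unrooted) trees of total weight $n$ that have $L$ as a limb approaches $1$ as $n\to\infty$.
   Context: A weighted tree is a finite (unrooted) tree in which each vertex is assigned a positive integer weight; a weighted rooted tree is such a tree with a distinguished root vertex. The total weight is the sum of the weights of all vertices. Weighted trees are counted up to weight-preserving isomorphism; there are finitely many of each total weight $n$. Let $T$ be a weighted tree and $v\in V(T)$. A branch at $v$ is a maximal subtree of $T$ in which $v$ has degree $1$ (with weights inherited from $T$). A limb at $v$ is the weighted rooted subtree, with root $v$, formed by a (possibly empty) collection of branches at $v$. The tree $T$ has $L$ as a limb if for some $v\in V(T)$ there is a limb at $v$ isomorphic to $L$ as a weighted rooted tree (isomorphism preserving root and weights). -}

module Defs where

open import Data.Fin.Base using (Fin; zero; suc; inject₁; fromℕ)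
open import Data.Fin.Subset using (Subset; _∈_; _⊆_; _∪_; ⁅_⁆; ⊥; ∣_∣)
open import Data.Fin.Subset.Properties using (x∈p∪q⁻; x∈p∪q⁺; x∈⁅x⁆; ∉⊥)
open import Data.Integer.Base using (+_)
open import Data.List.Base using (List; foldr; tabulate; []; _∷_)
open import Data.List.Relation.Unary.All using (All)
open import Data.Nat.Base using (ℕ; suc; _≤_; _<_; NonZero)
open import Data.Nat.ListAction using (sum)
open import Data.Product.Base using (Σ; ∃; ∃-syntax; _×_; _,_; proj₁; proj₂)
open import Data.Rational.Base as ℚ using (ℚ; 0ℚ)
open import Data.Sum.Base using (inj₁; inj₂; [_,_]′)
open import Function.Base using (_∘_)
open import Function.Bundles using (_↔_; _⇔_; Inverse)
open import Function.Definitions using (Injective)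
open import Relation.Binary.Construct.Closure.ReflexiveTransitive using (Star)
open import Relation.Binary.Definitions using (Symmetric)
open import Relation.Binary.PropositionalEquality using (_≡_)
open import Relation.Nullary.Negation using (¬_; contradiction)

-- Weighted graphs on an arbitrary vertex type, so that trees, their
-- subgraphs, and isomorphisms between any of these share one definition.
record WGraph : Set₁ where
  field
    Vertex : Set
    _~_    : Vertex → Vertex → Set
    weight : Vertex → ℕ

-- The cycle c₀ ~ c₁ ~ … ~ c₍ₖ₊₂₎ ~ c₀ has length k + 3.
record Cycle (G : WGraph) : Set where
  open WGraph G
  field
    k        : ℕ
    c        : Fin (suc (suc (suc k))) → Vertex
    distinct : Injective _≡_ _≡_ c
    step     : ∀ i → c (inject₁ i) ~ c (suc i)
    close    : c (fromℕ (suc (suc k))) ~ c zero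

record IsTree (G : WGraph) : Set where
  open WGraph G
  field
    ~-sym     : Symmetric _~_
    loopless  : ∀ x → ¬ (x ~ x)
    nonempty  : Vertex
    connected : ∀ x y → Star _~_ x y
    acyclic   : ¬ Cycle G

record _≅_ (G H : WGraph) : Set where
  private
    module G = WGraph G
    module H = WGraph H
  field
    bijection : G.Vertex ↔ H.Vertex
  open Inverse bijection public using (to)
  field
    adjacency : ∀ x y → (x G.~ y) ⇔ (to x H.~ to y)
    weights   : ∀ x → H.weight (to x) ≡ G.weight x

RootedIso : (G : WGraph) → WGraph.Vertex G → (H : WGraph) → WGraph.Vertex H → Set
RootedIso G r H s = Σ (G ≅ H) λ f → _≅_.to f r ≡ s

finGraph : (m : ℕ) → (Fin m → Subset m) → (Fin m → ℕ) → WGraph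
finGraph m nbrs wt = record
  { Vertex = Fin m
  ; _~_    = λ x y → y ∈ nbrs x
  ; weight = wt
  }

record WeightedTree : Set where
  field
    order      : ℕ
    neighbours : Fin order → Subset order
    weight     : Fin order → ℕ
    positive   : ∀ x → 0 < weight x
  graph : WGraph
  graph = finGraph order neighbours weight
  field
    isTree     : IsTree graph

  totalWeight : ℕ
  totalWeight = sum (tabulate weight)

record WeightedRootedTree : Set where
  field
    tree : WeightedTree
  open WeightedTree tree public
  field
    root : Fin order

module _ (T : WeightedTree) where
  open WeightedTree T

  -- E x is the set of y such that xy is an edge of the subgraph.
  record Subgraph : Set where
    field
      V     : Subset order
      E     : Fin order → Subset order
      E-sym : ∀ {x y} → y ∈ E x → x ∈ E y
      E⇒V   : ∀ {x y} → y ∈ E x → x ∈ V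
      E⇒nbr : ∀ {x y} → y ∈ E x → y ∈ neighbours x

    -- Membership x ∈ V is proof-irrelevant, so ∃ (_∈ V) is the vertex set V.
    subgraph : WGraph
    subgraph = record
      { Vertex = ∃ (_∈ V)
      ; _~_    = λ x y → proj₁ y ∈ E (proj₁ x)
      ; weight = λ x → weight (proj₁ x)
      }

    degree : Fin order → ℕ
    degree x = ∣ E x ∣

  open Subgraph

  _⊑_ : Subgraph → Subgraph → Set
  S ⊑ S′ = V S ⊆ V S′ × (∀ x → E S x ⊆ E S′ x)

  single : Fin order → Subgraph
  single v = record
    { V     = ⁅ v ⁆
    ; E     = λ _ → ⊥
    ; E-sym = λ p → contradiction p ∉⊥
    ; E⇒V   = λ p → contradiction p ∉⊥
    ; E⇒nbr = λ p → contradiction p ∉⊥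
    }

  _⊔_ : Subgraph → Subgraph → Subgraph
  S ⊔ S′ = record
    { V     = V S ∪ V S′
    ; E     = λ x → E S x ∪ E S′ x
    ; E-sym = λ {x} {y} p → x∈p∪q⁺
        ([ inj₁ ∘ E-sym S , inj₂ ∘ E-sym S′ ]′ (x∈p∪q⁻ (E S x) (E S′ x) p))
    ; E⇒V   = λ {x} {y} p → x∈p∪q⁺
        ([ inj₁ ∘ E⇒V S , inj₂ ∘ E⇒V S′ ]′ (x∈p∪q⁻ (E S x) (E S′ x) p))
    ; E⇒nbr = λ {x} {y} p →
        [ E⇒nbr S , E⇒nbr S′ ]′ (x∈p∪q⁻ (E S x) (E S′ x) p)
    }

  SubtreeWithLeaf : Fin order → Subgraph → Set
  SubtreeWithLeaf v S = IsTree (subgraph S) × v ∈ V S × degree S v ≡ 1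

  IsBranch : Fin order → Subgraph → Set
  IsBranch v B = SubtreeWithLeaf v B
               × (∀ S → SubtreeWithLeaf v S → B ⊑ S → S ⊑ B)

  -- The union of {v} with a collection of subgraphs; it is {v} when the
  -- collection is empty.
  limb : Fin order → List Subgraph → Subgraph
  limb v = foldr _⊔_ (single v)

  v∈limb : ∀ v Bs → v ∈ V (limb v Bs)
  v∈limb v []       = x∈⁅x⁆ v
  v∈limb v (B ∷ Bs) = x∈p∪q⁺ (inj₂ (v∈limb v Bs))

  HasLimb : WeightedRootedTree → Set
  HasLimb L =
    ∃[ v ] Σ (List Subgraph) λ Bs →
      All (IsBranch v) Bs
      × RootedIso (WeightedRootedTree.graph L) (WeightedRootedTree.root L)
                  (subgraph (limb v Bs)) (v , v∈limb v Bs)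

-- c is the number of isomorphism classes of weighted trees satisfying P, as
-- witnessed by a complete list of pairwise non-isomorphic representatives.
-- This reading presupposes that P is invariant under isomorphism.
record CountUpToIso (P : WeightedTree → Set) (c : ℕ) : Set where
  open WeightedTree using (graph)
  field
    rep      : Fin c → WeightedTree
    sound    : ∀ i → P (rep i)
    distinct : ∀ i j → graph (rep i) ≅ graph (rep j) → i ≡ j
    complete : ∀ T → P T → ∃[ i ] (graph T ≅ graph (rep i))

record IsProportion (n : ℕ) (Q : WeightedTree → Set) (p : ℚ) : Set where
  open WeightedTree using (totalWeight)
  field
    all           : ℕ
    favourable    : ℕ
    allCount      : CountUpToIso (λ T → totalWeight T ≡ n) all
    favourCount   : CountUpToIso (λ T → totalWeight T ≡ n × Q T) favourable
    {{all-nonZero}} : NonZero all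
    ratio         : p ≡ (+ favourable) ℚ./ all

_⟶_ : (ℕ → ℚ) → ℚ → Set
s ⟶ l = (ε : ℚ) → 0ℚ ℚ.< ε →
        ∃[ N ] (∀ n → N ≤ n → ℚ.∣ s n ℚ.- l ∣ ℚ.< ε)

{-# OPTIONS --safe #-}

-- Fix L of weight l. Call a limb at a vertex, or a stretch of a path together with its side branches, a
-- piece if its weight is between l + 2 and 2 (l + 2). A rooted tree of weight n contains at least c n disjoint
-- pieces, and there are finitely many pieces, so one piece P occurs at least c′ n times. If the tree avoids L,
-- replace x of these occurrences by a branch Q₀ and y of them by another branch Q₁, where Q₀ and Q₁ have the
-- weight of P and contain L. Since L occurs nowhere else, the original tree, x and y can be recovered from the
-- resulting rooted tree and P. An unrooted tree of weight n has at most n rootings, so the number a of trees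
-- avoiding L and the number t of all trees of weight n satisfy a (c″ n)² ≤ C n t, whence a / t = O(1 / n).

module Submission where

open import Defs
open import Data.Bool.Base using (Bool; true; false)
open import Data.Empty using (⊥)
open import Data.Fin.Base using (Fin; zero; suc; inject₁; fromℕ; splitAt; join; _↑ˡ_; _↑ʳ_; toℕ; inject≤;
  combine; remQuot)
import Data.Fin.Properties as Fin
open import Data.Fin.Relation.Unary.Top using (view; ‵fromℕ; ‵inject₁)
open import Data.Fin.Subset using (Subset; _∈_; inside; outside; _∉_; _∪_; ⁅_⁆; ∣_∣)
open import Data.Fin.Subset.Properties using (x∈p∪q⁻; x∈p∪q⁺; x∈⁅x⁆; x∈⁅y⁆⇒x≡y; _∈?_; ⊆-antisym; ∣⁅x⁆∣≡1)
import Data.Integer.Base as ℤ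
import Data.Integer.Properties as ℤ
open import Data.List.Base using (tabulate; List; []; _∷_; _++_; map; length; filter; upTo;
  cartesianProductWith; lookup; foldr)
open import Data.List.Membership.Propositional using (find; lose) renaming (_∈_ to _∈ˡ_)
open import Data.List.Membership.Propositional.Properties using (∈-++⁺ˡ; ∈-++⁺ʳ; ∈-map⁺;
  ∈-cartesianProductWith⁺; ∈-upTo⁺; ∈-filter⁺; ∈-filter⁻; ∈-lookup)
import Data.List.Properties as List
open import Data.List.Relation.Unary.All as All using (All; []; _∷_)
import Data.List.Relation.Unary.All.Properties as All
open import Data.List.Relation.Unary.AllPairs using (AllPairs; []; _∷_)
import Data.List.Relation.Unary.AllPairs.Properties as AllPairs
open import Data.List.Relation.Unary.Any as Any using (Any; here; there; any?)
import Data.List.Relation.Unary.Any.Properties as AnyP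
open import Data.Maybe.Base using (Maybe; just; nothing; maybe′)
open import Data.Nat.Base using (ℕ; zero; suc; _+_; _≤_; _<_; z≤n; s≤s; pred; >-nonZero; s≤s⁻¹; _*_; _∸_;
  NonZero; _/_; _%_)
open import Data.Nat.DivMod using (m≡m%n+[m/n]*n; m%n<n; m*n/n≡m; /-monoˡ-≤; m/n*n≤m)
open import Data.Nat.ListAction using (sum)
open import Data.Nat.Properties
open import Data.Nat.Tactic.RingSolver using (solve-∀)
open import Data.Product.Base using (Σ; ∃; _×_; _,_; proj₁; proj₂)
open import Data.Rational.Base as ℚ using (ℚ; mkℚ; 0ℚ; 1ℚ; toℚᵘ)
import Data.Rational.Properties as ℚ
open import Data.Rational.Unnormalised.Base as ℚᵘ using (ℚᵘ; mkℚᵘ; 1ℚᵘ; *≡*; *<*)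
import Data.Rational.Unnormalised.Properties as ℚᵘ
open import Data.Sum.Base as Sum using (_⊎_; inj₁; inj₂; [_,_]′; [_,_])
open import Data.Sum.Properties using (inj₁-injective; inj₂-injective; ≡-dec)
open import Data.Unit.Base using (⊤; tt)
import Data.Vec.Base as Vec
open import Data.Vec.Base using (here; there; _∷_)
import Data.Vec.Properties as Vec
open import Data.Vec.Properties.WithK using ([]=-irrelevant)
open import Function.Base using (_∘_; id)
open import Function.Bundles using (Inverse; mk↔ₛ′; mk⇔; Equivalence)
open import Function.Definitions using (Injective)
open import Relation.Binary.Construct.Closure.ReflexiveTransitive using (Star; ε; _◅_; _◅◅_; gmap; reverse)
open import Relation.Binary.Definitions using (DecidableEquality)
open import Relation.Binary.PropositionalEquality hiding ([_])
open import Relation.Nullary.Decidable using (Dec; yes; no; _×-dec_; does; dec-true; map′; _⊎-dec_; ¬?;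
  decidable-stable; _→-dec_)
open import Relation.Nullary.Negation using (¬_; contradiction)

open import Algebra.Properties.CommutativeMonoid.Sum +-0-commutativeMonoid using (sum-permute)
  renaming (sum to ∑)

-- Passing from an encoded rooted tree to its isomorphism class forgets the root, at the price of a
-- factor up to `n`. A single kind of marker would give only about `n` encodings per tree and hence
-- a bounded ratio; two independently counted kinds give about `n²`, and one factor `n` survives.
-- Both markers must have the weight of the piece and be distinguishable from each other, and
-- recovery also needs that no subtree with a trade inside it is mistaken for a marker: it is always
-- too heavy to be one. Two kinds of pieces are needed because of two opposite shapes. A star has no
-- large branches below its centre and must be cut into bundles of branches at one vertex; a long
-- path hanging from its end has only nested branches and must be cut into stretches. A vertex of
-- large weight behaves like a star whose branches are units of weight.

infix 4 _~~_

-- Weighted rooted trees: vert k is a single vertex of weight k + 1, and graft a b hangs a below the root of b.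
data Term : Set where
  vert  : ℕ → Term
  graft : Term → Term → Term

wt : Term → ℕ
wt (vert k)    = suc k
wt (graft a b) = wt a + wt b

Pos : Term → Set
Pos (vert _)    = ⊤
Pos (graft a b) = Pos a ⊎ Pos b

root : ∀ t → Pos t
root (vert _)    = tt
root (graft a b) = inj₂ (root b)

vw : ∀ t → Pos t → ℕ
vw (vert k)    _        = suc k
vw (graft a b) (inj₁ x) = vw a x
vw (graft a b) (inj₂ y) = vw b y

Adj : ∀ t → Pos t → Pos t → Set
Adj (vert _)    _        _        = ⊥
Adj (graft a b) (inj₁ x) (inj₁ y) = Adj a x y
Adj (graft a b) (inj₁ x) (inj₂ y) = x ≡ root a × y ≡ root b
Adj (graft a b) (inj₂ y) (inj₁ x) = x ≡ root a × y ≡ root b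
Adj (graft a b) (inj₂ x) (inj₂ y) = Adj b x y

G : Term → WGraph
G t = record { Vertex = Pos t ; _~_ = Adj t ; weight = vw t }

Adj-sym : ∀ t {x y} → Adj t x y → Adj t y x
Adj-sym (graft a b) {inj₁ x} {inj₁ y} p = Adj-sym a p
Adj-sym (graft a b) {inj₁ x} {inj₂ y} p = p
Adj-sym (graft a b) {inj₂ x} {inj₁ y} p = p
Adj-sym (graft a b) {inj₂ x} {inj₂ y} p = Adj-sym b p

-- Isomorphisms of graphs and of rooted terms

record Iso (G H : WGraph) : Set where
  private
    module G = WGraph G
    module H = WGraph H
  field
    to      : G.Vertex → H.Vertex
    from    : H.Vertex → G.Vertex
    to-from : ∀ y → to (from y) ≡ y
    from-to : ∀ x → from (to x) ≡ x
    adj     : ∀ {x y} → x G.~ y → to x H.~ to y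
    adj⁻    : ∀ {x y} → to x H.~ to y → x G.~ y
    weights : ∀ x → H.weight (to x) ≡ G.weight x

  to-inj : ∀ {x y} → to x ≡ to y → x ≡ y
  to-inj {x} {y} p = trans (sym (from-to x)) (trans (cong from p) (from-to y))

open Iso

iso-refl : ∀ {G} → Iso G G
iso-refl = record
  { to = id ; from = id ; to-from = λ _ → refl ; from-to = λ _ → refl
  ; adj = id ; adj⁻ = id ; weights = λ _ → refl }

iso-sym : ∀ {G H} → Iso G H → Iso H G
iso-sym {G} {H} f = record
  { to = from f ; from = to f ; to-from = from-to f ; from-to = to-from f
  ; adj = λ {x} {y} p → adj⁻ f (subst₂ (WGraph._~_ H) (sym (to-from f x)) (sym (to-from f y)) p)
  ; adj⁻ = λ {x} {y} p → subst₂ (WGraph._~_ H) (to-from f x) (to-from f y) (adj f p)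
  ; weights = λ y → trans (sym (weights f (from f y))) (cong (WGraph.weight H) (to-from f y)) }

iso-trans : ∀ {G H K} → Iso G H → Iso H K → Iso G K
iso-trans f g = record
  { to = to g ∘ to f ; from = from f ∘ from g
  ; to-from = λ z → trans (cong (to g) (to-from f (from g z))) (to-from g z)
  ; from-to = λ x → trans (cong (from f) (from-to g (to f x))) (from-to f x)
  ; adj = adj g ∘ adj f ; adj⁻ = adj⁻ f ∘ adj⁻ g
  ; weights = λ x → trans (weights g (to f x)) (weights f x) }

Iso⇒≅ : ∀ {G H} → Iso G H → G ≅ H
Iso⇒≅ f = record
  { bijection = mk↔ₛ′ (to f) (from f) (to-from f) (from-to f)
  ; adjacency = λ x y → mk⇔ (adj f) (adj⁻ f)
  ; weights   = weights f }

≅⇒Iso : ∀ {G H} → G ≅ H → Iso G H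
≅⇒Iso f = record
  { to = Inverse.to b ; from = Inverse.from b
  ; to-from = λ y → Inverse.inverseˡ b refl
  ; from-to = λ x → Inverse.inverseʳ b refl
  ; adj = λ {x} {y} → Equivalence.to (_≅_.adjacency f x y)
  ; adj⁻ = λ {x} {y} → Equivalence.from (_≅_.adjacency f x y)
  ; weights = _≅_.weights f }
  where b = _≅_.bijection f

-- Isomorphism of rooted trees: the children of a vertex form a multiset.
data _~~_ : Term → Term → Set where
  ~~-refl  : ∀ {t} → t ~~ t
  ~~-sym   : ∀ {s t} → s ~~ t → t ~~ s
  ~~-trans : ∀ {s t u} → s ~~ t → t ~~ u → s ~~ u
  ~~-graft : ∀ {a a′ b b′} → a ~~ a′ → b ~~ b′ → graft a b ~~ graft a′ b′
  ~~-swap  : ∀ {a b t} → graft a (graft b t) ~~ graft b (graft a t)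

record TIso (s t : Term) : Set where
  constructor _,ʳ_
  field
    iso    : Iso (G s) (G t)
    rooted : to iso (root s) ≡ root t
open TIso

tiso-refl : ∀ {t} → TIso t t
tiso-refl = iso-refl ,ʳ refl

tiso-sym : ∀ {s t} → TIso s t → TIso t s
tiso-sym (f ,ʳ r) = iso-sym f ,ʳ trans (cong (from f) (sym r)) (from-to f _)

tiso-trans : ∀ {s t u} → TIso s t → TIso t u → TIso s u
tiso-trans (f ,ʳ r) (g ,ʳ q) = iso-trans f g ,ʳ trans (cong (to g) r) q

tiso-graft : ∀ {a a′ b b′} → TIso a a′ → TIso b b′ → TIso (graft a b) (graft a′ b′)
tiso-graft {a} {a′} {b} {b′} (f ,ʳ r) (g ,ʳ q) = record
  { to = [ inj₁ ∘ to f , inj₂ ∘ to g ]′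
  ; from = [ inj₁ ∘ from f , inj₂ ∘ from g ]′
  ; to-from = λ { (inj₁ x) → cong inj₁ (to-from f x) ; (inj₂ x) → cong inj₂ (to-from g x) }
  ; from-to = λ { (inj₁ x) → cong inj₁ (from-to f x) ; (inj₂ x) → cong inj₂ (from-to g x) }
  ; adj = λ {x} {y} → ad x y
  ; adj⁻ = λ {x} {y} → ad⁻ x y
  ; weights = λ { (inj₁ x) → weights f x ; (inj₂ x) → weights g x } } ,ʳ cong inj₂ q
  where
  h : Pos (graft a b) → Pos (graft a′ b′)
  h = [ inj₁ ∘ to f , inj₂ ∘ to g ]′
  ad : ∀ x y → Adj (graft a b) x y → Adj (graft a′ b′) (h x) (h y)
  ad (inj₁ x) (inj₁ y) p = adj f p
  ad (inj₁ x) (inj₂ y) (refl , refl) = r , q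
  ad (inj₂ x) (inj₁ y) (refl , refl) = r , q
  ad (inj₂ x) (inj₂ y) p = adj g p
  ad⁻ : ∀ x y → Adj (graft a′ b′) (h x) (h y) → Adj (graft a b) x y
  ad⁻ (inj₁ x) (inj₁ y) p = adj⁻ f p
  ad⁻ (inj₁ x) (inj₂ y) (p , p′) = to-inj f (trans p (sym r)) , to-inj g (trans p′ (sym q))
  ad⁻ (inj₂ x) (inj₁ y) (p , p′) = to-inj f (trans p (sym r)) , to-inj g (trans p′ (sym q))
  ad⁻ (inj₂ x) (inj₂ y) p = adj⁻ g p

tiso-swap : ∀ {a b t} → TIso (graft a (graft b t)) (graft b (graft a t))
tiso-swap {a} {b} {t} = record
  { to = sw ; from = sw
  ; to-from = sw² ; from-to = sw²
  ; adj = λ {x} {y} → ad x y ; adj⁻ = λ {x} {y} → ad⁻ x y ; weights = w } ,ʳ refl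
  where
  sw : ∀ {A B C : Set} → A ⊎ (B ⊎ C) → B ⊎ (A ⊎ C)
  sw (inj₁ x) = inj₂ (inj₁ x)
  sw (inj₂ (inj₁ x)) = inj₁ x
  sw (inj₂ (inj₂ x)) = inj₂ (inj₂ x)
  sw² : ∀ {A B C : Set} (x : A ⊎ (B ⊎ C)) → sw (sw x) ≡ x
  sw² (inj₁ x) = refl
  sw² (inj₂ (inj₁ x)) = refl
  sw² (inj₂ (inj₂ x)) = refl
  ad : ∀ {a b t} x y → Adj (graft a (graft b t)) x y → Adj (graft b (graft a t)) (sw x) (sw y)
  ad (inj₁ x) (inj₁ y) p = p
  ad (inj₁ x) (inj₂ (inj₂ y)) (p , refl) = p , refl
  ad (inj₂ (inj₁ x)) (inj₂ (inj₁ y)) p = p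
  ad (inj₂ (inj₁ x)) (inj₂ (inj₂ y)) (p , q) = p , cong inj₂ q
  ad (inj₂ (inj₂ x)) (inj₁ y) (p , refl) = p , refl
  ad (inj₂ (inj₂ x)) (inj₂ (inj₁ y)) (p , q) = p , cong inj₂ q
  ad (inj₂ (inj₂ x)) (inj₂ (inj₂ y)) p = p
  ad⁻ : ∀ {a b t} x y → Adj (graft b (graft a t)) (sw x) (sw y) → Adj (graft a (graft b t)) x y
  ad⁻ {a} {b} {t} x y p =
    subst₂ (Adj (graft a (graft b t))) (sw² x) (sw² y) (ad {b} {a} {t} (sw x) (sw y) p)
  w : ∀ x → vw (graft b (graft a t)) (sw x) ≡ vw (graft a (graft b t)) x
  w (inj₁ x) = refl
  w (inj₂ (inj₁ x)) = refl
  w (inj₂ (inj₂ x)) = refl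

~~⇒TIso : ∀ {s t} → s ~~ t → TIso s t
~~⇒TIso ~~-refl        = tiso-refl
~~⇒TIso (~~-sym p)     = tiso-sym (~~⇒TIso p)
~~⇒TIso (~~-trans p q) = tiso-trans (~~⇒TIso p) (~~⇒TIso q)
~~⇒TIso (~~-graft p q) = tiso-graft (~~⇒TIso p) (~~⇒TIso q)
~~⇒TIso (~~-swap {a} {b} {t}) = tiso-swap {a} {b} {t}

-- One `~~-swap` per level moves the chosen child of the root past the children listed before it.
pull : ∀ t u → Adj t u (root t) →
  Σ Term λ a → Σ Term λ b → t ~~ graft a b × Σ (TIso t (graft a b)) λ f → to (iso f) u ≡ inj₁ (root a)
pull (graft a b) (inj₁ x) (p , _) = a , b , ~~-refl , tiso-refl , cong inj₁ p
pull (graft a b) (inj₂ y) p with pull b y p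
... | c , d , eq , f , fy =
  c , graft a d , ~~-trans (~~-graft ~~-refl eq) ~~-swap ,
  tiso-trans (tiso-graft (tiso-refl {a}) f) (tiso-swap {a} {c} {d}) ,
  trans (cong (to (iso (tiso-swap {a} {c} {d})) ∘ inj₂) fy) refl

fromRoot : ∀ t x → Star (Adj t) (root t) x
fromRoot (vert _)    tt       = ε
fromRoot (graft a b) (inj₂ y) = gmap inj₂ id (fromRoot b y)
fromRoot (graft a b) (inj₁ x) = (refl , refl) ◅ gmap inj₁ id (fromRoot a x)

module _ {a b a′ b′ : Term} (f : Iso (G (graft a b)) (G (graft a′ b′)))
         (f-root : to f (inj₂ (root b)) ≡ inj₂ (root b′))
         (f-child : to f (inj₁ (root a)) ≡ inj₁ (root a′)) where

  private
    -- The only edge between the two halves joins their roots. A step whose image crossed over would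
    -- land on `root b′`, which is already the image of `root b`.
    left : ∀ {x y} → Star (Adj a) x y → ∀ z → to f (inj₁ x) ≡ inj₁ z → ∃ λ z′ → to f (inj₁ y) ≡ inj₁ z′
    left ε z eq = z , eq
    left (_◅_ {j = x′} p ps) z eq with to f (inj₁ x′) in eq′ | adj f {inj₁ _} {inj₁ x′} p
    ... | inj₁ z′ | _ = left ps z′ eq′
    ... | inj₂ w  | q rewrite eq with q
    ...   | _ , refl = contradiction (to-inj f (trans eq′ (sym f-root))) λ ()

    right : ∀ {x y} → Star (Adj b) x y → ∀ z → to f (inj₂ x) ≡ inj₂ z → ∃ λ z′ → to f (inj₂ y) ≡ inj₂ z′
    right ε z eq = z , eq
    right (_◅_ {j = x′} p ps) z eq with to f (inj₂ x′) in eq′ | adj f {inj₂ _} {inj₂ x′} p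
    ... | inj₂ z′ | _ = right ps z′ eq′
    ... | inj₁ w  | q rewrite eq with q
    ...   | refl , _ = contradiction (to-inj f (trans eq′ (sym f-child))) λ ()

  restrictˡ : ∀ x → ∃ λ z → to f (inj₁ x) ≡ inj₁ z
  restrictˡ x = left (fromRoot a x) (root a′) f-child

  restrictʳ : ∀ y → ∃ λ z → to f (inj₂ y) ≡ inj₂ z
  restrictʳ y = right (fromRoot b y) (root b′) f-root

module _ {a b a′ b′ : Term} (f : Iso (G (graft a b)) (G (graft a′ b′)))
         (f-root : to f (inj₂ (root b)) ≡ inj₂ (root b′))
         (f-child : to f (inj₁ (root a)) ≡ inj₁ (root a′)) where
  private
    f⁻-root : from f (inj₂ (root b′)) ≡ inj₂ (root b)
    f⁻-root = trans (cong (from f) (sym f-root)) (from-to f _)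
    f⁻-child : from f (inj₁ (root a′)) ≡ inj₁ (root a)
    f⁻-child = trans (cong (from f) (sym f-child)) (from-to f _)
    l = restrictˡ f f-root f-child
    r = restrictʳ f f-root f-child
    l⁻ = restrictˡ (iso-sym f) f⁻-root f⁻-child
    r⁻ = restrictʳ (iso-sym f) f⁻-root f⁻-child

  tiso-child : TIso a a′
  tiso-child = record
    { to = proj₁ ∘ l ; from = proj₁ ∘ l⁻
    ; to-from = λ y → inj₁-injective (trans (sym (proj₂ (l _))) (trans (cong (to f) (sym (proj₂ (l⁻ y)))) (to-from f _)))
    ; from-to = λ x → inj₁-injective (trans (sym (proj₂ (l⁻ _))) (trans (cong (from f) (sym (proj₂ (l x)))) (from-to f _)))
    ; adj = λ {x} {y} p → subst₂ (Adj (graft a′ b′)) (proj₂ (l x)) (proj₂ (l y)) (adj f p)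
    ; adj⁻ = λ {x} {y} p → adj⁻ f {inj₁ x} {inj₁ y} (subst₂ (Adj (graft a′ b′)) (sym (proj₂ (l x))) (sym (proj₂ (l y))) p)
    ; weights = λ x → trans (cong (vw (graft a′ b′)) (sym (proj₂ (l x)))) (weights f (inj₁ x))
    } ,ʳ inj₁-injective (trans (sym (proj₂ (l _))) f-child)

  tiso-rest : TIso b b′
  tiso-rest = record
    { to = proj₁ ∘ r ; from = proj₁ ∘ r⁻
    ; to-from = λ y → inj₂-injective (trans (sym (proj₂ (r _))) (trans (cong (to f) (sym (proj₂ (r⁻ y)))) (to-from f _)))
    ; from-to = λ x → inj₂-injective (trans (sym (proj₂ (r⁻ _))) (trans (cong (from f) (sym (proj₂ (r x)))) (from-to f _)))
    ; adj = λ {x} {y} p → subst₂ (Adj (graft a′ b′)) (proj₂ (r x)) (proj₂ (r y)) (adj f p)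
    ; adj⁻ = λ {x} {y} p → adj⁻ f {inj₂ x} {inj₂ y} (subst₂ (Adj (graft a′ b′)) (sym (proj₂ (r x))) (sym (proj₂ (r y))) p)
    ; weights = λ x → trans (cong (vw (graft a′ b′)) (sym (proj₂ (r x)))) (weights f (inj₂ x))
    } ,ʳ inj₂-injective (trans (sym (proj₂ (r _))) f-root)

-- The image of the first child is pulled to the front of `t`. The isomorphism then respects one
-- edge at the root and splits along it into two smaller rooted isomorphisms.
TIso⇒~~ : ∀ s t → TIso s t → s ~~ t
TIso⇒~~ (vert k) (vert l) (f ,ʳ _) with refl ← weights f tt = ~~-refl
TIso⇒~~ (vert k) (graft a b) (f ,ʳ _) =
  contradiction (trans (sym (to-from f (inj₁ (root a)))) (to-from f (inj₂ (root b)))) λ ()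
TIso⇒~~ (graft a b) t (f ,ʳ r)
  with c , d , eq , (g ,ʳ q) , gu ← pull t (to f (inj₁ (root a)))
         (subst (Adj t _) r (adj f {inj₁ (root a)} {inj₂ (root b)} (refl , refl)))
  = ~~-trans (~~-graft (TIso⇒~~ a c (tiso-child h hr gu)) (TIso⇒~~ b d (tiso-rest h hr gu))) (~~-sym eq)
  where
  h = iso-trans f g
  hr = trans (cong (to g) r) q

-- The graph of a term is a tree

depth : ∀ t → Pos t → ℕ
depth (vert _)    _        = 0
depth (graft a b) (inj₁ x) = suc (depth a x)
depth (graft a b) (inj₂ y) = depth b y

depth-root : ∀ t → depth t (root t) ≡ 0
depth-root (vert _)    = refl
depth-root (graft a b) = depth-root b

depth-adj : ∀ t x y → Adj t x y → depth t x ≢ depth t y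
depth-adj (graft a b) (inj₁ x) (inj₁ y) p eq = depth-adj a x y p (cong-pred eq)
  where cong-pred : ∀ {m n} → suc m ≡ suc n → m ≡ n
        cong-pred refl = refl
depth-adj (graft a b) (inj₁ x) (inj₂ y) (refl , refl) eq = contradiction (trans eq (depth-root b)) λ ()
depth-adj (graft a b) (inj₂ x) (inj₁ y) (refl , refl) eq = contradiction (trans (sym eq) (depth-root b)) λ ()
depth-adj (graft a b) (inj₂ x) (inj₂ y) p eq = depth-adj b x y p eq

parent-unique : ∀ t x y z → Adj t x y → Adj t x z →
  depth t y < depth t x → depth t z < depth t x → y ≡ z
parent-unique (graft a b) (inj₁ x) (inj₁ y) (inj₁ z) p q (s≤s l) (s≤s m) =
  cong inj₁ (parent-unique a x y z p q l m)
parent-unique (graft a b) (inj₁ x) (inj₁ y) (inj₂ z) p (refl , _) (s≤s l) m =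
  contradiction (subst (suc (depth a y) ≤_) (depth-root a) l) λ ()
parent-unique (graft a b) (inj₁ x) (inj₂ y) (inj₁ z) (refl , _) q l (s≤s m) =
  contradiction (subst (suc (depth a z) ≤_) (depth-root a) m) λ ()
parent-unique (graft a b) (inj₁ x) (inj₂ y) (inj₂ z) (_ , refl) (_ , refl) l m = refl
parent-unique (graft a b) (inj₂ x) (inj₁ y) z (_ , refl) q l m =
  contradiction (subst (suc (depth a y) <_) (depth-root b) l) λ ()
parent-unique (graft a b) (inj₂ x) (inj₂ y) (inj₁ z) p (_ , refl) l m =
  contradiction (subst (depth b y <_) (depth-root b) l) λ ()
parent-unique (graft a b) (inj₂ x) (inj₂ y) (inj₂ z) p q l m =
  cong inj₂ (parent-unique b x y z p q l m)

maximum : ∀ {n} (f : Fin (suc n) → ℕ) → ∃ λ i → ∀ j → f j ≤ f i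
maximum {zero}  f = zero , λ { zero → ≤-refl }
maximum {suc n} f with maximum (f ∘ suc)
... | i , m with ≤-total (f zero) (f (suc i))
... | inj₁ le = suc i , λ { zero → le ; (suc j) → m j }
... | inj₂ ge = zero  , λ { zero → ≤-refl ; (suc j) → ≤-trans (m j) ge }

module _ {G : WGraph} (~-sym : ∀ {x y} → WGraph._~_ G x y → WGraph._~_ G y x) (C : Cycle G) where
  open WGraph G
  open Cycle C

  cycle-neighbours : ∀ i → ∃ λ j → ∃ λ l → j ≢ l × c i ~ c j × c i ~ c l
  cycle-neighbours zero = suc zero , suc (fromℕ (suc k)) , (λ ()) , step zero , ~-sym close
  cycle-neighbours (suc i) with view i
  ... | ‵fromℕ = inject₁ (fromℕ (suc k)) , zero , (λ ()) , ~-sym (step (fromℕ (suc k))) , close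
  ... | ‵inject₁ j = inject₁ (inject₁ j) , suc (suc j) , ne j , ~-sym (step (inject₁ j)) , step (suc j)
    where
    ne : ∀ {n} (j : Fin n) → inject₁ (inject₁ j) ≢ suc (suc j)
    ne (suc j) eq = ne j (Fin.suc-injective eq)

-- A deepest vertex of a cycle would have two distinct neighbours on it, both strictly less deep
-- because adjacent depths differ; that makes two parents.
G-acyclic : ∀ t → ¬ Cycle (G t)
G-acyclic t C with maximum (depth t ∘ Cycle.c C)
... | i , m with cycle-neighbours (Adj-sym t) C i
... | j , l , ne , p , q = ne (Cycle.distinct C (parent-unique t _ _ _ p q (lower p j refl refl) (lower q l refl refl)))
  where
  lower : ∀ {x y} → Adj t x y → ∀ j → Cycle.c C j ≡ y → x ≡ Cycle.c C i → depth t y < depth t x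
  lower p j refl refl = ≤∧≢⇒< (m j) (≢-sym (depth-adj t _ _ p))

path : ∀ t x y → Star (Adj t) x y
path (vert _)    x        y        = ε
path (graft a b) (inj₁ x) (inj₁ y) = gmap inj₁ id (path a x y)
path (graft a b) (inj₁ x) (inj₂ y) =
  gmap inj₁ id (path a x (root a)) ◅◅ ((refl , refl) ◅ gmap inj₂ id (path b (root b) y))
path (graft a b) (inj₂ x) (inj₁ y) =
  gmap inj₂ id (path b x (root b)) ◅◅ ((refl , refl) ◅ gmap inj₁ id (path a (root a) y))
path (graft a b) (inj₂ x) (inj₂ y) = gmap inj₂ id (path b x y)

G-isTree : ∀ t → IsTree (G t)
G-isTree t = record
  { ~-sym     = Adj-sym t
  ; loopless  = λ x p → depth-adj t x x p refl
  ; nonempty  = root t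
  ; connected = path t
  ; acyclic   = G-acyclic t }

-- Simple paths in a tree

AllV : {A : Set} {R : A → A → Set} (P : A → Set) {x y : A} → Star R x y → Set
AllV P {x} ε       = P x
AllV P {x} (_ ◅ s) = P x × AllV P s

Simple : {A : Set} {R : A → A → Set} {x y : A} → Star R x y → Set
Simple         ε       = ⊤
Simple {x = x} (_ ◅ s) = AllV (x ≢_) s × Simple s

module _ {A : Set} {R : A → A → Set} where

  AllV-universal : ∀ {P : A → Set} → (∀ x → P x) → ∀ {x y} (s : Star R x y) → AllV P s
  AllV-universal p ε       = p _
  AllV-universal p (_ ◅ s) = p _ , AllV-universal p s

  AllV-map : ∀ {P Q : A → Set} → (∀ {x} → P x → Q x) → ∀ {x y} (s : Star R x y) → AllV P s → AllV Q s
  AllV-map f ε       p       = f p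
  AllV-map f (_ ◅ s) (p , q) = f p , AllV-map f s q

  AllV-head : ∀ {P : A → Set} {x y} (s : Star R x y) → AllV P s → P x
  AllV-head ε       p       = p
  AllV-head (_ ◅ s) (p , _) = p

  AllV-++ : ∀ {P : A → Set} {x y z w} (s : Star R x y) {r : R y z} (s′ : Star R z w) →
            AllV P s → AllV P s′ → AllV P (s ◅◅ (r ◅ s′))
  AllV-++ ε       s′ p       q = p , q
  AllV-++ (_ ◅ s) s′ (p , u) q = p , AllV-++ s s′ u q

  Simple-++ : ∀ {x y z w} (s : Star R x y) {r : R y z} (s′ : Star R z w) →
              Simple s → Simple s′ → AllV (λ v → AllV (v ≢_) s′) s → Simple (s ◅◅ (r ◅ s′))
  Simple-++ ε       s′ _       q d       = d , q
  Simple-++ (_ ◅ s) s′ (p , u) q (d , e) = AllV-++ s s′ p d , Simple-++ s s′ u q e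

  module _ {B : Set} {S : B → B → Set} (f : A → B) (g : ∀ {x y} → R x y → S (f x) (f y)) where

    AllV-gmap : ∀ (P : B → Set) {x y} (s : Star R x y) → AllV (P ∘ f) s → AllV P (gmap {U = S} f g s)
    AllV-gmap P ε       p       = p
    AllV-gmap P (_ ◅ s) (p , q) = p , AllV-gmap P s q

    Simple-gmap : Injective _≡_ _≡_ f → ∀ {x y} (s : Star R x y) → Simple s → Simple (gmap {U = S} f g s)
    Simple-gmap inj ε       _       = tt
    Simple-gmap inj (_ ◅ s) (p , q) =
      AllV-gmap _ s (AllV-map (λ ne eq → ne (inj eq)) s p) , Simple-gmap inj s q

path-simple : ∀ t x y → Simple (path t x y)
path-simple (vert _)    x        y        = tt
path-simple (graft a b) (inj₁ x) (inj₁ y) = Simple-gmap inj₁ id inj₁-injective (path a x y) (path-simple a x y)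
path-simple (graft a b) (inj₂ x) (inj₂ y) = Simple-gmap inj₂ id inj₂-injective (path b x y) (path-simple b x y)
path-simple (graft a b) (inj₁ x) (inj₂ y) =
  Simple-++ (gmap inj₁ id p) (gmap inj₂ id q)
    (Simple-gmap inj₁ id inj₁-injective p (path-simple a x (root a)))
    (Simple-gmap inj₂ id inj₂-injective q (path-simple b (root b) y))
    (AllV-gmap {S = Adj (graft a b)} inj₁ id _ p (AllV-universal (λ v → AllV-gmap {S = Adj (graft a b)} inj₂ id (inj₁ v ≢_) q (AllV-universal (λ _ ()) q)) p))
  where p = path a x (root a)
        q = path b (root b) y
path-simple (graft a b) (inj₂ x) (inj₁ y) =
  Simple-++ (gmap inj₂ id p) (gmap inj₁ id q)
    (Simple-gmap inj₂ id inj₂-injective p (path-simple b x (root b)))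
    (Simple-gmap inj₁ id inj₁-injective q (path-simple a (root a) y))
    (AllV-gmap {S = Adj (graft a b)} inj₂ id _ p (AllV-universal (λ v → AllV-gmap {S = Adj (graft a b)} inj₁ id (inj₂ v ≢_) q (AllV-universal (λ _ ()) q)) p))
  where p = path b x (root b)
        q = path a (root a) y

module _ {A : Set} {R : A → A → Set} where

  len : ∀ {x y} → Star R x y → ℕ
  len ε       = 0
  len (_ ◅ s) = suc (len s)

  at : ∀ {x y} (s : Star R x y) → Fin (suc (len s)) → A
  at {x} s       zero    = x
  at     (_ ◅ s) (suc i) = at s i

  at-step : ∀ {x y} (s : Star R x y) i → R (at s (inject₁ i)) (at s (suc i))
  at-step (r ◅ ε)       zero    = r
  at-step (r ◅ (_ ◅ s)) zero    = r
  at-step (r ◅ s)       (suc i) = at-step s i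

  at-last : ∀ {x y} (s : Star R x y) → at s (fromℕ (len s)) ≡ y
  at-last ε       = refl
  at-last (_ ◅ s) = at-last s

  AllV-at : ∀ {P : A → Set} {x y} (s : Star R x y) → AllV P s → ∀ i → P (at s i)
  AllV-at s       p       zero    = AllV-head s p
  AllV-at (_ ◅ s) (_ , p) (suc i) = AllV-at s p i

  at-injective : ∀ {x y} (s : Star R x y) → Simple s → Injective _≡_ _≡_ (at s)
  at-injective s       _       {zero}  {zero}  _  = refl
  at-injective (_ ◅ s) (p , _) {zero}  {suc j} eq = contradiction eq (AllV-at s p j)
  at-injective (_ ◅ s) (p , _) {suc i} {zero}  eq = contradiction (sym eq) (AllV-at s p i)
  at-injective (_ ◅ s) (_ , q) {suc i} {suc j} eq = cong suc (at-injective s q eq)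

-- Excluding `x ≡ y` and `R x y` leaves a path of at least two steps, so the cycle has the required
-- three vertices.
cycle-from-path : ∀ {A : Set} {R : A → A → Set} {H : WGraph} (let open WGraph H) (f : A → Vertex) →
  Injective _≡_ _≡_ f → (∀ {x y} → R x y → f x ~ f y) →
  ∀ {x y} (s : Star R x y) → Simple s → x ≢ y → ¬ R x y → f y ~ f x → Cycle H
cycle-from-path f inj hom ε _ ne _ _ = contradiction refl ne
cycle-from-path f inj hom (r ◅ ε) _ _ nr _ = contradiction r nr
cycle-from-path {H = H} f inj hom s@(_ ◅ (_ ◅ s″)) simple _ _ closing = record
  { k = len s″ ; c = f ∘ at s ; distinct = λ p → at-injective s simple (inj p)
  ; step = λ i → hom (at-step s i)
  ; close = subst (λ z → WGraph._~_ H (f z) _) (sym (at-last s)) closing }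

_≟Pos_ : ∀ {t} → DecidableEquality (Pos t)
_≟Pos_ {vert _}    tt tt = yes refl
_≟Pos_ {graft a b} = ≡-dec _≟Pos_ _≟Pos_

adj? : ∀ t x y → Dec (Adj t x y)
adj? (vert _)    _        _        = no λ ()
adj? (graft a b) (inj₁ x) (inj₁ y) = adj? a x y
adj? (graft a b) (inj₁ x) (inj₂ y) = (x ≟Pos root a) ×-dec (y ≟Pos root b)
adj? (graft a b) (inj₂ y) (inj₁ x) = (x ≟Pos root a) ×-dec (y ≟Pos root b)
adj? (graft a b) (inj₂ x) (inj₂ y) = adj? b x y

cycle-map : ∀ {G H : WGraph} (let module G = WGraph G) (let module H = WGraph H)
  (f : G.Vertex → H.Vertex) → Injective _≡_ _≡_ f →
  (∀ {x y} → x G.~ y → f x H.~ f y) → Cycle G → Cycle H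
cycle-map f inj adj C = record
  { k = k ; c = f ∘ c ; distinct = λ p → distinct (inj p) ; step = λ i → adj (step i) ; close = adj close }
  where open Cycle C

isTree-iso : ∀ {G H} → Iso G H → IsTree G → IsTree H
isTree-iso {G} {H} f T = record
  { ~-sym     = λ p → adj⁻ (iso-sym f) (~-sym (adj (iso-sym f) p))
  ; loopless  = λ x p → loopless _ (adj (iso-sym f) p)
  ; nonempty  = to f nonempty
  ; connected = λ x y → subst₂ (Star (WGraph._~_ H)) (to-from f x) (to-from f y)
                          (gmap (to f) (adj f) (connected (from f x) (from f y)))
  ; acyclic   = λ C → acyclic (cycle-map (from f) (to-inj (iso-sym f)) (adj (iso-sym f)) C) }
  where
  open IsTree T
  open Iso

open Iso

-- Terms as weighted trees on Fin n

fromDec : ∀ {n} {P : Fin n → Set} → (∀ x → Dec (P x)) → Subset n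
fromDec P? = Vec.tabulate (does ∘ P?)

module _ {n} {P : Fin n → Set} (P? : ∀ x → Dec (P x)) where

  ∈-fromDec⁺ : ∀ {x} → P x → x ∈ fromDec P?
  ∈-fromDec⁺ {x} p = Vec.lookup⇒[]= x _ (trans (Vec.lookup∘tabulate _ x) (dec-true (P? x) p))

  ∈-fromDec⁻ : ∀ {x} → x ∈ fromDec P? → P x
  ∈-fromDec⁻ {x} q with P? x | trans (sym (Vec.lookup∘tabulate (does ∘ P?) x)) (Vec.[]=⇒lookup q)
  ... | yes p | _ = p

ord : Term → ℕ
ord (vert _)    = 1
ord (graft a b) = ord a + ord b

toFin : ∀ {t} → Pos t → Fin (ord t)
toFin {vert _}    _ = zero
toFin {graft a b} x = join (ord a) (ord b) (Sum.map toFin toFin x)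

fromFin : ∀ {t} → Fin (ord t) → Pos t
fromFin {vert _}    _ = _
fromFin {graft a b} i = Sum.map fromFin fromFin (splitAt (ord a) i)

fromFin-toFin : ∀ {t} (x : Pos t) → fromFin (toFin x) ≡ x
fromFin-toFin {vert _} _ = refl
fromFin-toFin {graft a b} (inj₁ x)
  rewrite Fin.splitAt-join (ord a) (ord b) (inj₁ (toFin x)) = cong inj₁ (fromFin-toFin x)
fromFin-toFin {graft a b} (inj₂ y)
  rewrite Fin.splitAt-join (ord a) (ord b) (inj₂ (toFin y)) = cong inj₂ (fromFin-toFin y)

toFin-fromFin : ∀ {t} (i : Fin (ord t)) → toFin (fromFin {t} i) ≡ i
toFin-fromFin {vert _} zero = refl
toFin-fromFin {graft a b} i with splitAt (ord a) i in eq
... | inj₁ j = trans (cong (join (ord a) (ord b) ∘ inj₁) (toFin-fromFin {a} j))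
                     (trans (cong (join (ord a) (ord b)) (sym eq)) (Fin.join-splitAt (ord a) (ord b) i))
... | inj₂ j = trans (cong (join (ord a) (ord b) ∘ inj₂) (toFin-fromFin {b} j))
                     (trans (cong (join (ord a) (ord b)) (sym eq)) (Fin.join-splitAt (ord a) (ord b) i))

vw>0 : ∀ t x → 0 < vw t x
vw>0 (vert _)    _        = s≤s z≤n
vw>0 (graft a b) (inj₁ x) = vw>0 a x
vw>0 (graft a b) (inj₂ y) = vw>0 b y

nbrs : ∀ t → Fin (ord t) → Subset (ord t)
nbrs t x = fromDec λ y → adj? t (fromFin x) (fromFin y)

finIso : ∀ t → Iso (G t) (finGraph (ord t) (nbrs t) (vw t ∘ fromFin))
finIso t = record
  { to = toFin ; from = fromFin ; to-from = toFin-fromFin {t} ; from-to = fromFin-toFin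
  ; adj = λ {x} {y} p → ∈-fromDec⁺ (λ z → adj? t (fromFin (toFin x)) (fromFin z)) (subst₂ (Adj t) (sym (fromFin-toFin x)) (sym (fromFin-toFin y)) p)
  ; adj⁻ = λ {x} {y} p → subst₂ (Adj t) (fromFin-toFin x) (fromFin-toFin y)
                           (∈-fromDec⁻ (λ z → adj? t (fromFin (toFin x)) (fromFin z)) p)
  ; weights = λ x → cong (vw t) (fromFin-toFin x) }

toWT : Term → WeightedTree
toWT t = record
  { order = ord t ; neighbours = nbrs t ; weight = vw t ∘ fromFin
  ; positive = vw>0 t ∘ fromFin ; isTree = isTree-iso (finIso t) (G-isTree t) }

sum-tabulate-++ : ∀ m {n} (f : Fin (m + n) → ℕ) →
  sum (tabulate f) ≡ sum (tabulate (f ∘ (_↑ˡ n))) + sum (tabulate (f ∘ (m ↑ʳ_)))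
sum-tabulate-++ zero    f = refl
sum-tabulate-++ (suc m) f = trans (cong (f zero +_) (sum-tabulate-++ m (f ∘ suc))) (sym (+-assoc (f zero) _ _))

totalWeight-toWT : ∀ t → WeightedTree.totalWeight (toWT t) ≡ wt t
totalWeight-toWT (vert k) = +-identityʳ (suc k)
totalWeight-toWT (graft a b) = trans (sum-tabulate-++ (ord a) _) (cong₂ _+_
  (trans (cong sum (List.tabulate-cong λ i → cong (vw (graft a b) ∘ Sum.map fromFin fromFin) (Fin.splitAt-↑ˡ (ord a) i (ord b)))) (totalWeight-toWT a))
  (trans (cong sum (List.tabulate-cong λ i → cong (vw (graft a b) ∘ Sum.map fromFin fromFin) (Fin.splitAt-↑ʳ (ord a) (ord b) i))) (totalWeight-toWT b)))

sum-tabulate : ∀ {n} (f : Fin n → ℕ) → sum (tabulate f) ≡ ∑ f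
sum-tabulate {zero}  f = refl
sum-tabulate {suc n} f = cong (f zero +_) (sum-tabulate (f ∘ suc))

totalWeight-iso : ∀ T T′ → Iso (WeightedTree.graph T) (WeightedTree.graph T′) →
  WeightedTree.totalWeight T ≡ WeightedTree.totalWeight T′
totalWeight-iso T T′ f = sym (begin
  sum (tabulate T′.weight)          ≡⟨ sum-tabulate T′.weight ⟩
  ∑ T′.weight                       ≡⟨ sum-permute T′.weight (_≅_.bijection (Iso⇒≅ f)) ⟩
  ∑ (T′.weight ∘ to f)              ≡⟨ sum-tabulate (T′.weight ∘ to f) ⟨
  sum (tabulate (T′.weight ∘ to f)) ≡⟨ cong sum (List.tabulate-cong (weights f)) ⟩
  sum (tabulate T.weight)           ∎)
  where
  open ≡-Reasoning
  module T = WeightedTree T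
  module T′ = WeightedTree T′

-- Every weighted tree is the graph of a term

anyPos? : ∀ t {P : Pos t → Set} → (∀ x → Dec (P x)) → Dec (∃ P)
anyPos? (vert _)    P? = map′ (tt ,_) proj₂ (P? tt)
anyPos? (graft a b) P? = map′ [ (λ (x , p) → inj₁ x , p) , (λ (x , p) → inj₂ x , p) ]′
  (λ { (inj₁ x , p) → inj₁ (x , p) ; (inj₂ x , p) → inj₂ (x , p) })
  (anyPos? a (P? ∘ inj₁) ⊎-dec anyPos? b (P? ∘ inj₂))

-- Edges need only be preserved: when `H` is a tree, `reflect` shows that they are reflected as
-- well.
record Emb (H : WGraph) (t : Term) : Set where
  open WGraph H
  field
    emb     : Pos t → Vertex
    inj     : Injective _≡_ _≡_ emb
    adj     : ∀ {x y} → Adj t x y → emb x ~ emb y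
    weights : ∀ x → weight (emb x) ≡ vw t x

open Emb renaming (inj to emb-inj; adj to emb-adj; weights to emb-weights)

module _ {H : WGraph} (T : IsTree H) where
  open WGraph H
  open IsTree T

  vertEmb : ∀ v k → weight v ≡ suc k → Emb H (vert k)
  vertEmb v k eq = record { emb = λ _ → v ; inj = λ _ → refl ; adj = λ () ; weights = λ _ → eq }

  graftEmb : ∀ {a b} (A : Emb H a) (B : Emb H b) → (∀ x y → emb A x ≢ emb B y) →
             emb A (root a) ~ emb B (root b) → Emb H (graft a b)
  graftEmb {a} {b} A B disj e = record
    { emb = f
    ; inj = λ {x} {y} → f-inj x y ; adj = λ {x} {y} → f-adj x y
    ; weights = λ { (inj₁ x) → emb-weights A x ; (inj₂ y) → emb-weights B y } }
    where
    f = [ emb A , emb B ]′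
    f-inj : ∀ x y → f x ≡ f y → x ≡ y
    f-inj (inj₁ x) (inj₁ y) p = cong inj₁ (emb-inj A p)
    f-inj (inj₁ x) (inj₂ y) p = contradiction p (disj x y)
    f-inj (inj₂ x) (inj₁ y) p = contradiction (sym p) (disj y x)
    f-inj (inj₂ x) (inj₂ y) p = cong inj₂ (emb-inj B p)
    f-adj : ∀ x y → Adj (graft a b) x y → f x ~ f y
    f-adj (inj₁ x) (inj₁ y) p = emb-adj A p
    f-adj (inj₁ x) (inj₂ y) (refl , refl) = e
    f-adj (inj₂ x) (inj₁ y) (refl , refl) = ~-sym e
    f-adj (inj₂ x) (inj₂ y) p = emb-adj B p

  leftEmb : ∀ {a b} → Emb H (graft a b) → Emb H a
  leftEmb E = record { emb = emb E ∘ inj₁ ; inj = λ p → inj₁-inj (emb-inj E p) ; adj = emb-adj E ; weights = emb-weights E ∘ inj₁ }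
    where inj₁-inj : ∀ {A B : Set} {x y : A} → inj₁ {B = B} x ≡ inj₁ y → x ≡ y
          inj₁-inj refl = refl

  rightEmb : ∀ {a b} → Emb H (graft a b) → Emb H b
  rightEmb E = record { emb = emb E ∘ inj₂ ; inj = λ p → inj₂-inj (emb-inj E p) ; adj = emb-adj E ; weights = emb-weights E ∘ inj₂ }
    where inj₂-inj : ∀ {A B : Set} {x y : B} → inj₂ {A = A} x ≡ inj₂ y → x ≡ y
          inj₂-inj refl = refl

  -- `root≡` and `image` are what regrafting needs: the extended half still meets the untouched half
  -- in the same edge and stays disjoint from it.
  record Extension {t} (E : Emb H t) (y : Vertex) : Set where
    field
      {term} : Term
      ext    : Emb H term
      root≡  : emb ext (root term) ≡ emb E (root t)
      ord≡   : ord term ≡ suc (ord t)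
      image  : ∀ z → emb ext z ≡ y ⊎ ∃ λ z′ → emb ext z ≡ emb E z′

  extend : ∀ {t} (E : Emb H t) x y k → weight y ≡ suc k → (∀ z → emb E z ≢ y) → emb E x ~ y → Extension E y
  extend {vert _} E x y k w new e = record
    { ext   = graftEmb (vertEmb y k w) E (λ _ z p → new z (sym p)) (~-sym e)
    ; root≡ = refl ; ord≡ = refl
    ; image = λ { (inj₁ z) → inj₁ refl ; (inj₂ z) → inj₂ (z , refl) } }
  extend {graft a b} E (inj₁ x) y k w new e = record
    { ext   = graftEmb ext (rightEmb E) disj (subst (_~ _) (sym root≡) (emb-adj E {inj₁ _} {inj₂ _} (refl , refl)))
    ; root≡ = refl ; ord≡ = cong (_+ ord b) ord≡
    ; image = λ { (inj₁ z) → Sum.map id (λ (z′ , p) → inj₁ z′ , p) (image z) ; (inj₂ z) → inj₂ (inj₂ z , refl) } }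
    where
    open Extension (extend (leftEmb E) x y k w (new ∘ inj₁) e)
    disj : ∀ z z′ → emb ext z ≢ emb E (inj₂ z′)
    disj z z′ p with image z
    ... | inj₁ q = new (inj₂ z′) (trans (sym p) q)
    ... | inj₂ (z″ , q) = contradiction (emb-inj E (trans (sym q) p)) λ ()
  extend {graft a b} E (inj₂ x) y k w new e = record
    { ext   = graftEmb (leftEmb E) ext disj (subst (_ ~_) (sym root≡) (emb-adj E {inj₁ _} {inj₂ _} (refl , refl)))
    ; root≡ = root≡ ; ord≡ = trans (cong (ord a +_) ord≡) (+-suc _ _)
    ; image = λ { (inj₂ z) → Sum.map id (λ (z′ , p) → inj₂ z′ , p) (image z) ; (inj₁ z) → inj₂ (inj₁ z , refl) } }
    where
    open Extension (extend (rightEmb E) x y k w (new ∘ inj₂) e)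
    disj : ∀ z z′ → emb E (inj₁ z) ≢ emb ext z′
    disj z z′ p with image z′
    ... | inj₁ q = new (inj₁ z) (trans p q)
    ... | inj₂ (z″ , q) = contradiction (emb-inj E (trans p q)) λ ()

  -- An edge of H missing from an embedded tree would close a cycle with the tree path between its ends.
  reflect : ∀ {t} (E : Emb H t) {x y} → emb E x ~ emb E y → Adj t x y
  reflect {t} E {x} {y} e = decidable-stable (adj? t x y) λ na → acyclic
    (cycle-from-path (emb E) (emb-inj E) (emb-adj E) (path t x y) (path-simple t x y) (λ { refl → loopless _ e }) na (~-sym e))

  spanning : ∀ {t} (E : Emb H t) → (∀ y → ∃ λ x → emb E x ≡ y) → Iso (G t) H
  spanning E onto = record
    { to = emb E ; from = proj₁ ∘ onto ; to-from = proj₂ ∘ onto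
    ; from-to = λ x → emb-inj E (proj₂ (onto _))
    ; adj = emb-adj E ; adj⁻ = reflect E ; weights = emb-weights E }

module _ (T : WeightedTree) where
  open WeightedTree T hiding (weight)
  open WGraph graph
  open IsTree isTree

  private
    covered? : ∀ {t} (E : Emb graph t) y → Dec (∃ λ x → emb E x ≡ y)
    covered? {t} E y = anyPos? t λ x → emb E x Fin.≟ y

    crossing : ∀ {t} (E : Emb graph t) {u v} → Star _~_ u v → (∃ λ x → emb E x ≡ u) → ¬ (∃ λ x → emb E x ≡ v) →
      Σ (Pos t) λ x → Σ Vertex λ y → emb E x ~ y × ¬ (∃ λ x → emb E x ≡ y)
    crossing E ε c nc = contradiction c nc
    crossing E (_◅_ {j = w} e p) (x , refl) nc with covered? E w
    ... | yes c = crossing E p c nc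
    ... | no nw = x , w , e , nw

    ord≤order : ∀ {t} → Emb graph t → ord t ≤ order
    ord≤order {t} E = Fin.injective⇒≤ {f = emb E ∘ fromFin} λ p →
      Iso.to-inj (iso-sym (finIso t)) (emb-inj E p)

    -- `k` bounds the number of vertices still missing. At `k = 0` a further extension would embed
    -- more than `order` vertices into `Fin order`.
    grow : ∀ k {t} (E : Emb graph t) → order ≤ ord t + k →
      Σ Term λ t′ → Σ (Iso (G t′) graph) λ f → Iso.to f (root t′) ≡ emb E (root t)
    grow k {t} E le with Fin.all? (covered? E)
    ... | yes onto = t , spanning isTree E onto , refl
    ... | no ¬onto with Fin.¬∀⟶∃¬ _ _ (covered? E) ¬onto
    ... | v , nv with crossing E (connected (emb E (root t)) v) (root t , refl) nv
    ... | x , y , e , ny = continue k le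
      where
      open Extension (extend isTree E x y (pred (weight y)) (sym (suc-pred (weight y) ⦃ >-nonZero (positive y) ⦄))
                             (λ z p → ny (z , p)) e)
      continue : ∀ k → order ≤ ord t + k → Σ Term λ t′ → Σ (Iso (G t′) graph) λ f → Iso.to f (root t′) ≡ emb E (root t)
      continue zero    le = contradiction (subst (_≤ order) ord≡ (ord≤order ext)) (<⇒≱ (s≤s (subst (order ≤_) (+-identityʳ _) le)))
      continue (suc k) le with t′ , f , r ← grow k ext (subst (order ≤_) (trans (+-suc _ k) (cong (_+ k) (sym ord≡))) le)
        = t′ , f , trans r root≡

  -- Grow a subtree from r, one leaf at a time, until it spans.
  toTerm : ∀ r → Σ Term λ t → Σ (Iso (G t) graph) λ f → Iso.to f (root t) ≡ r
  toTerm r = grow order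
    (vertEmb isTree r (pred (weight r)) (sym (suc-pred (weight r) ⦃ >-nonZero (positive r) ⦄))) (n≤1+n order)

open Subgraph

-- Limbs as closed embeddings

-- No edge of H leaves the image except at the image of the root.
record ClosedEmb (H : WGraph) (t : Term) : Set where
  open WGraph H
  field
    base   : Emb H t
    closed : ∀ {x} → x ≢ root t → ∀ {y} → emb base x ~ y → ∃ λ z → emb base z ≡ y

open ClosedEmb

∃-≡ : ∀ {n} {p : Subset n} {x y : ∃ (_∈ p)} → proj₁ x ≡ proj₁ y → x ≡ y
∃-≡ {x = x , p} {y = .x , q} refl = cong (x ,_) ([]=-irrelevant p q)

∣p∣≡0⇒∉ : ∀ {n} {p : Subset n} {x} → ∣ p ∣ ≡ 0 → x ∉ p
∣p∣≡0⇒∉ {p = outside ∷ p} eq (there i) = ∣p∣≡0⇒∉ eq i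

∣p∣≡1⇒unique : ∀ {n} {p : Subset n} {x y} → ∣ p ∣ ≡ 1 → x ∈ p → y ∈ p → x ≡ y
∣p∣≡1⇒unique                    eq here      here      = refl
∣p∣≡1⇒unique                    eq here      (there j) = contradiction j (∣p∣≡0⇒∉ (suc-injective eq))
∣p∣≡1⇒unique                    eq (there i) here      = contradiction i (∣p∣≡0⇒∉ (suc-injective eq))
∣p∣≡1⇒unique {p = inside ∷ p}  eq (there i) (there j) = contradiction i (∣p∣≡0⇒∉ (suc-injective eq))
∣p∣≡1⇒unique {p = outside ∷ p} eq (there i) (there j) = cong suc (∣p∣≡1⇒unique eq i j)

module _ (T : WeightedTree) where
  open WeightedTree T
  open IsTree isTree

  subgraph-isTree : ∀ (S : Subgraph T) (h : ∃ (_∈ V S)) →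
    (∀ x → Star (WGraph._~_ (subgraph S)) h x) → IsTree (subgraph S)
  subgraph-isTree S h reach = record
    { ~-sym     = E-sym S
    ; loopless  = λ x p → loopless (proj₁ x) (E⇒nbr S p)
    ; nonempty  = h
    ; connected = λ x y → reverse (E-sym S) (reach x) ◅◅ reach y
    ; acyclic   = λ C → acyclic (cycle-map proj₁ ∃-≡ (E⇒nbr S) C) }

  module _ {x y} (e : y ∈ neighbours x) where

    private
      Ends : Fin order → Fin order → Set
      Ends z w = (z ≡ x × w ≡ y) ⊎ (z ≡ y × w ≡ x)

      ends? : ∀ z w → Dec (Ends z w)
      ends? z w = ((z Fin.≟ x) ×-dec (w Fin.≟ y)) ⊎-dec ((z Fin.≟ y) ×-dec (w Fin.≟ x))

    edge : Subgraph T
    edge = record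
      { V     = ⁅ x ⁆ ∪ ⁅ y ⁆
      ; E     = fromDec ∘ ends?
      ; E-sym = λ {z} {w} p → ∈-fromDec⁺ (ends? w) (flip′ (∈-fromDec⁻ (ends? z) p))
      ; E⇒V   = λ {z} p → in-V (∈-fromDec⁻ (ends? z) p)
      ; E⇒nbr = λ {z} p → nbr (∈-fromDec⁻ (ends? z) p) }
      where
      flip′ : ∀ {z w} → Ends z w → Ends w z
      flip′ (inj₁ (p , q)) = inj₂ (q , p)
      flip′ (inj₂ (p , q)) = inj₁ (q , p)
      in-V : ∀ {z w} → Ends z w → z ∈ ⁅ x ⁆ ∪ ⁅ y ⁆
      in-V (inj₁ (refl , _)) = x∈p∪q⁺ (inj₁ (x∈⁅x⁆ x))
      in-V (inj₂ (refl , _)) = x∈p∪q⁺ (inj₂ (x∈⁅x⁆ y))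
      nbr : ∀ {z w} → Ends z w → w ∈ neighbours z
      nbr (inj₁ (refl , refl)) = e
      nbr (inj₂ (refl , refl)) = ~-sym e

    xy∈edge : y ∈ E edge x
    xy∈edge = ∈-fromDec⁺ (ends? x) (inj₁ (refl , refl))

    edge-ends : ∀ {z w} → w ∈ E edge z → z ≡ x ⊎ z ≡ y
    edge-ends {z} p = Sum.map proj₁ proj₁ (∈-fromDec⁻ (ends? z) p)

  -- Otherwise adding the edge xy to B would give a larger subtree in which v still has degree 1.
  branch-closed : ∀ {v B} → IsBranch T v B → ∀ {x y} → x ∈ V B → x ≢ v → y ∈ neighbours x → y ∈ V B
  branch-closed {v} {B} ((B-tree , v∈B , deg) , maximal) {x} {y} x∈B x≢v e with y ∈? V B
  ... | yes y∈B = y∈B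
  ... | no  y∉B = contradiction (proj₁ (maximal B⁺ (B⁺-tree , v∈B⁺ , deg⁺) B⊑B⁺) y∈B⁺) y∉B
    where
    B⁺ : Subgraph T
    B⁺ = _⊔_ T B (edge e)
    ∈ˡ : ∀ {z} → z ∈ V B → z ∈ V B⁺
    ∈ˡ p = x∈p∪q⁺ (inj₁ p)
    Eˡ : ∀ {z w} → w ∈ E B z → w ∈ E B⁺ z
    Eˡ p = x∈p∪q⁺ (inj₁ p)
    B⊑B⁺ : _⊑_ T B B⁺
    B⊑B⁺ = ∈ˡ , λ z → Eˡ
    v∈B⁺ = ∈ˡ v∈B
    y∈B⁺ : y ∈ V B⁺
    y∈B⁺ = x∈p∪q⁺ (inj₂ (E⇒V (edge e) (E-sym (edge e) {x} (xy∈edge e))))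
    reach : ∀ z → Star (WGraph._~_ (subgraph B⁺)) (x , ∈ˡ x∈B) z
    reach (z , p) with x∈p∪q⁻ (V B) (V (edge e)) p
    ... | inj₁ z∈B = subst (Star _ _) (∃-≡ refl)
            (gmap (λ (u , q) → u , ∈ˡ q) Eˡ (IsTree.connected B-tree (x , x∈B) (z , z∈B)))
    ... | inj₂ z∈e with x∈p∪q⁻ ⁅ x ⁆ ⁅ y ⁆ z∈e
    ... | inj₁ q = subst (Star _ _) (∃-≡ (sym (x∈⁅y⁆⇒x≡y x q))) ε
    ... | inj₂ q = subst (Star _ _) (∃-≡ {x = y , y∈B⁺} (sym (x∈⁅y⁆⇒x≡y y q))) (x∈p∪q⁺ (inj₂ (xy∈edge e)) ◅ ε)
    B⁺-tree : IsTree (subgraph B⁺)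
    B⁺-tree = subgraph-isTree B⁺ (x , ∈ˡ x∈B) reach
    deg⁺ : degree B⁺ v ≡ 1
    deg⁺ = trans (cong ∣_∣ (⊆-antisym (λ {w} p → back (x∈p∪q⁻ (E B v) (E (edge e) v) p)) Eˡ)) deg
      where
      back : ∀ {w} → w ∈ E B v ⊎ w ∈ E (edge e) v → w ∈ E B v
      back (inj₁ p) = p
      back {w} (inj₂ p) with edge-ends e {v} {w} p
      ... | inj₁ refl = contradiction refl x≢v
      ... | inj₂ refl = contradiction v∈B y∉B

  limb-closed : ∀ {v} Bs → All (IsBranch T v) Bs → ∀ {x y} → x ∈ V (limb T v Bs) → x ≢ v →
    y ∈ neighbours x → y ∈ V (limb T v Bs)
  limb-closed {v} [] [] p ne e = contradiction (x∈⁅y⁆⇒x≡y v p) ne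
  limb-closed {v} (B ∷ Bs) (b ∷ bs) p ne e with x∈p∪q⁻ (V B) (V (limb T v Bs)) p
  ... | inj₁ q = x∈p∪q⁺ (inj₁ (branch-closed {B = B} b q ne e))
  ... | inj₂ q = x∈p∪q⁺ (inj₂ (limb-closed Bs bs q ne e))

  -- A branch at `v` with `v` removed: by `closed` and `only`, the edge between `v` and the image of
  -- `root a` is the single one leading out.
  record ChildEmb (v : Fin order) (a : Term) : Set where
    field
      base   : Emb graph a
      joined : emb base (root a) ∈ neighbours v
      closed : ∀ x {y} → y ∈ neighbours (emb base x) → y ≡ v ⊎ ∃ λ z → emb base z ≡ y
      only   : ∀ x → emb base x ∈ neighbours v → x ≡ root a

  module _ {v a} (A : ChildEmb v a) where
    private module A = ChildEmb A

    InBranch : Fin order → Set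
    InBranch y = y ≡ v ⊎ ∃ λ z → emb A.base z ≡ y

    inBranch? : ∀ y → Dec (InBranch y)
    inBranch? y = (y Fin.≟ v) ⊎-dec anyPos? a λ z → emb A.base z Fin.≟ y

    branchEdge? : ∀ x y → Dec (InBranch x × InBranch y × y ∈ neighbours x)
    branchEdge? x y = inBranch? x ×-dec inBranch? y ×-dec (y ∈? neighbours x)

    branch : Subgraph T
    branch = record
      { V     = fromDec inBranch?
      ; E     = fromDec ∘ branchEdge?
      ; E-sym = λ {x} {y} p → let (i , j , e) = ∈-fromDec⁻ (branchEdge? x) p in
                              ∈-fromDec⁺ (branchEdge? y) (j , i , ~-sym e)
      ; E⇒V   = λ {x} p → ∈-fromDec⁺ inBranch? (proj₁ (∈-fromDec⁻ (branchEdge? x) p))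
      ; E⇒nbr = λ {x} p → proj₂ (proj₂ (∈-fromDec⁻ (branchEdge? x) p)) }

    private
      ∈⁺ : ∀ {y} → InBranch y → y ∈ V branch
      ∈⁺ = ∈-fromDec⁺ inBranch?

      E⁺ : ∀ {x y} → InBranch x → InBranch y → y ∈ neighbours x → y ∈ E branch x
      E⁺ {x} i j e = ∈-fromDec⁺ (branchEdge? x) (i , j , e)

      v∈ : v ∈ V branch
      v∈ = ∈⁺ (inj₁ refl)

      in-child : ∀ x → InBranch (emb A.base x)
      in-child x = inj₂ (x , refl)

      reach : ∀ z → Star (WGraph._~_ (subgraph branch)) (v , v∈) z
      reach (z , p) with ∈-fromDec⁻ inBranch? p
      ... | inj₁ refl = subst (Star _ _) (∃-≡ refl) ε
      ... | inj₂ (x , refl) = E⁺ (inj₁ refl) (in-child (root a)) A.joined ◅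
        subst (Star _ _) (∃-≡ refl)
          (gmap (λ u → emb A.base u , ∈⁺ (in-child u))
                (λ {u} {w} e → E⁺ (in-child u) (in-child w) (emb-adj A.base e)) (path a (root a) x))

      leaf : ∀ {y} → y ∈ E branch v → y ≡ emb A.base (root a)
      leaf p with ∈-fromDec⁻ (branchEdge? v) p
      ... | _ , inj₁ refl , e = contradiction e (loopless v)
      ... | _ , inj₂ (x , refl) , e = cong (emb A.base) (A.only x e)

      root∈ : emb A.base (root a) ∈ E branch v
      root∈ = E⁺ (inj₁ refl) (in-child (root a)) A.joined

      deg : degree branch v ≡ 1
      deg = trans (cong ∣_∣ (⊆-antisym (λ p → subst (_∈ ⁅ emb A.base (root a) ⁆) (sym (leaf p)) (x∈⁅x⁆ _))
                                       (λ p → subst (_∈ E branch v) (sym (x∈⁅y⁆⇒x≡y _ p)) root∈)))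
                  (∣⁅x⁆∣≡1 (emb A.base (root a)))

      module _ (S : Subgraph T) (S-leaf : SubtreeWithLeaf T v S) (B⊑S : _⊑_ T branch S) where

        stays : ∀ {x y} → Star (WGraph._~_ (subgraph S)) x y → InBranch (proj₁ x) → InBranch (proj₁ y)
        stays ε i = i
        -- `S` contains the edge from `v` to the child, and `v` is a leaf of `S`, so a path in `S`
        -- has no other way to leave `v`.
        stays (e ◅ p) (inj₁ refl) = stays p (subst InBranch
          (∣p∣≡1⇒unique (proj₂ (proj₂ S-leaf)) (proj₂ B⊑S v root∈) e) (in-child (root a)))
        stays (e ◅ p) (inj₂ (u , refl)) = stays p (A.closed u (E⇒nbr S e))

        S⊑B : _⊑_ T S branch
        S⊑B = (λ p → ∈⁺ (within p)) , λ x e → E⁺ (within (E⇒V S e)) (within (E⇒V S (E-sym S e))) (E⇒nbr S e)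
          where
          within : ∀ {x} → x ∈ V S → InBranch x
          within p = stays (IsTree.connected (proj₁ S-leaf) (v , proj₁ (proj₂ S-leaf)) (_ , p)) (inj₁ refl)

    branch-isBranch : IsBranch T v branch
    branch-isBranch = (subgraph-isTree branch (v , v∈) reach , v∈ , deg) , S⊑B

  module _ {a b} (C : ClosedEmb graph (graft a b)) where
    private
      module C = ClosedEmb C

    firstChild : ChildEmb (emb C.base (inj₂ (root b))) a
    firstChild = record
      { base   = leftEmb isTree C.base
      ; joined = emb-adj C.base {inj₂ (root b)} {inj₁ (root a)} (refl , refl)
      ; closed = closed′
      ; only   = λ x e → proj₁ (reflect isTree C.base {inj₂ (root b)} {inj₁ x} e) }
      where
      closed′ : ∀ x {y} → y ∈ neighbours (emb C.base (inj₁ x)) → y ≡ emb C.base (inj₂ (root b)) ⊎ ∃ λ z → emb C.base (inj₁ z) ≡ y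
      closed′ x e with C.closed {inj₁ x} (λ ()) e
      ... | inj₁ z , p = inj₂ (z , p)
      ... | inj₂ z , refl = inj₁ (cong (emb C.base ∘ inj₂) (proj₂ (reflect isTree C.base {inj₁ x} {inj₂ z} e)))

    otherChildren : ClosedEmb graph b
    otherChildren = record { base = rightEmb isTree C.base ; closed = closed′ }
      where
      closed′ : ∀ {x} → x ≢ root b → ∀ {y} → y ∈ neighbours (emb C.base (inj₂ x)) → ∃ λ z → emb C.base (inj₂ z) ≡ y
      closed′ {x} ne e with C.closed {inj₂ x} (λ { refl → ne refl }) e
      ... | inj₂ z , p = z , p
      ... | inj₁ z , refl = contradiction (proj₂ (reflect isTree C.base {inj₂ x} {inj₁ z} e)) ne

  branches : ∀ {t} → ClosedEmb graph t → List (Subgraph T)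
  branches {vert _}    C = []
  branches {graft a b} C = branch (firstChild C) ∷ branches (otherChildren C)

  branches-areBranches : ∀ {t} (C : ClosedEmb graph t) → All (IsBranch T (emb (base C) (root t))) (branches C)
  branches-areBranches {vert _}    C = []
  branches-areBranches {graft a b} C = branch-isBranch (firstChild C) ∷ branches-areBranches (otherChildren C)

  module _ {t} (C : ClosedEmb graph t) where

    closedLimb : Subgraph T
    closedLimb = limb T (emb (base C) (root t)) (branches C)

  V-limb⁻ : ∀ {t} (C : ClosedEmb graph t) {y} → y ∈ V (closedLimb C) → ∃ λ x → emb (base C) x ≡ y
  V-limb⁻ {vert _} C p = tt , sym (x∈⁅y⁆⇒x≡y _ p)
  V-limb⁻ {graft a b} C p with x∈p∪q⁻ (V (branch (firstChild C))) _ p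
  ... | inj₁ q = [ (λ r → _ , sym r) , (λ (x , r) → inj₁ x , r) ]′ (∈-fromDec⁻ (inBranch? (firstChild C)) q)
  ... | inj₂ q = let (x , r) = V-limb⁻ (otherChildren C) q in inj₂ x , r

  V-limb⁺ : ∀ {t} (C : ClosedEmb graph t) x → emb (base C) x ∈ V (closedLimb C)
  V-limb⁺ {vert _} C tt = x∈⁅x⁆ _
  V-limb⁺ {graft a b} C (inj₁ x) = x∈p∪q⁺ (inj₁ (∈-fromDec⁺ (inBranch? (firstChild C)) (inj₂ (x , refl))))
  V-limb⁺ {graft a b} C (inj₂ y) = x∈p∪q⁺ (inj₂ (V-limb⁺ (otherChildren C) y))

  E-limb⁺ : ∀ {t} (C : ClosedEmb graph t) x y → Adj t x y → emb (base C) y ∈ E (closedLimb C) (emb (base C) x)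
  E-limb⁺ {graft a b} C x y p = x∈p∪q⁺ (in-E x y p)
    where
    A = firstChild C
    in-A : ∀ x y → InBranch A (emb (base C) x) → InBranch A (emb (base C) y) → Adj (graft a b) x y →
      emb (base C) y ∈ E (branch A) (emb (base C) x)
    in-A x y i j p = ∈-fromDec⁺ (branchEdge? A (emb (base C) x)) (i , j , emb-adj (base C) p)
    in-E : ∀ x y → Adj (graft a b) x y →
      emb (base C) y ∈ E (branch A) (emb (base C) x) ⊎ emb (base C) y ∈ E (closedLimb (otherChildren C)) (emb (base C) x)
    in-E (inj₁ x) (inj₁ y) p = inj₁ (in-A (inj₁ x) (inj₁ y) (inj₂ (x , refl)) (inj₂ (y , refl)) p)
    in-E (inj₁ x) (inj₂ y) p@(_ , refl) = inj₁ (in-A (inj₁ x) (inj₂ y) (inj₂ (x , refl)) (inj₁ refl) p)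
    in-E (inj₂ x) (inj₁ y) p@(_ , refl) = inj₁ (in-A (inj₂ x) (inj₁ y) (inj₁ refl) (inj₂ (y , refl)) p)
    in-E (inj₂ x) (inj₂ y) p = inj₂ (E-limb⁺ (otherChildren C) x y p)

  limbIsoTerm : ∀ {t} (C : ClosedEmb graph t) → Iso (G t) (subgraph (closedLimb C))
  limbIsoTerm C = record
    { to = λ x → emb (base C) x , V-limb⁺ C x
    ; from = λ (y , p) → proj₁ (V-limb⁻ C p)
    ; to-from = λ (y , p) → ∃-≡ (proj₂ (V-limb⁻ C p))
    ; from-to = λ x → emb-inj (base C) (proj₂ (V-limb⁻ C (V-limb⁺ C x)))
    ; adj = λ {x} {y} → E-limb⁺ C x y
    ; adj⁻ = λ p → reflect isTree (base C) (E⇒nbr (closedLimb C) p)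
    ; weights = emb-weights (base C) }

module _ (L : WeightedRootedTree) where
  private
    module L = WeightedRootedTree L
    rep = toTerm L.tree L.root

  limbTerm : Term
  limbTerm = proj₁ rep

  limbIso : Iso (G limbTerm) L.graph
  limbIso = proj₁ (proj₂ rep)

  limbIso-root : Iso.to limbIso (root limbTerm) ≡ L.root
  limbIso-root = proj₂ (proj₂ rep)

  -- By `limb-closed`, edges leave a union of branches only at `v`. Unlike a list of branches, a
  -- closed embedding can be searched for among finitely many functions and is carried along
  -- isomorphisms.
  HasLimb⇒ClosedEmb : ∀ T → HasLimb T L → ClosedEmb (WeightedTree.graph T) limbTerm
  HasLimb⇒ClosedEmb T (v , Bs , bs , f , f-root) = record
    { base = record
      { emb = proj₁ ∘ Iso.to g ; inj = λ p → Iso.to-inj g (∃-≡ p)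
      ; adj = λ p → E⇒nbr S (Iso.adj g p) ; weights = Iso.weights g }
    ; closed = λ {x} ne {y} e →
        let y∈S = limb-closed T Bs bs (proj₂ (Iso.to g x))
                    (λ eq → ne (Iso.to-inj g (trans (∃-≡ eq) (sym g-root)))) e
        in Iso.from g (y , y∈S) , cong proj₁ (Iso.to-from g (y , y∈S)) }
    where
    S = limb T v Bs
    g = iso-trans limbIso (≅⇒Iso f)
    g-root : Iso.to g (root limbTerm) ≡ (v , v∈limb T v Bs)
    g-root = trans (cong (_≅_.to f) limbIso-root) f-root

  -- The list of branches has one entry for each child of the root, and closedness makes each of
  -- these subtrees maximal.
  ClosedEmb⇒HasLimb : ∀ T → ClosedEmb (WeightedTree.graph T) limbTerm → HasLimb T L
  ClosedEmb⇒HasLimb T C =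
    emb (base C) (root limbTerm) , branches T C , branches-areBranches T C ,
    Iso⇒≅ (iso-trans (iso-sym limbIso) (limbIsoTerm T C)) ,
    ∃-≡ (cong (emb (base C)) (trans (cong (Iso.from limbIso) (sym limbIso-root)) (Iso.from-to limbIso _)))

-- Decidability and enumeration

allPos? : ∀ t {P : Pos t → Set} → (∀ x → Dec (P x)) → Dec (∀ x → P x)
allPos? (vert _)    P? = map′ (λ p _ → p) (λ p → p tt) (P? tt)
allPos? (graft a b) P? = map′ (λ (p , q) → [ p , q ]) (λ p → p ∘ inj₁ , p ∘ inj₂)
  (allPos? a (P? ∘ inj₁) ×-dec allPos? b (P? ∘ inj₂))

-- A function on `Pos (graft a b)` is only pointwise equal to some `[ f , g ]`, so `P` has to
-- respect `≗`.
anyFun? : ∀ s t {P : (Pos s → Pos t) → Set} → (∀ {f g} → f ≗ g → P f → P g) →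
  (∀ f → Dec (P f)) → Dec (∃ P)
anyFun? (vert _) t resp P? = map′ (λ (y , p) → (λ _ → y) , p) (λ (f , p) → f tt , resp (λ _ → refl) p)
  (anyPos? t λ y → P? (λ _ → y))
anyFun? (graft a b) t {P} resp P? = map′
  (λ (f , g , p) → [ f , g ] , p)
  (λ (h , p) → h ∘ inj₁ , h ∘ inj₂ , resp (λ { (inj₁ x) → refl ; (inj₂ y) → refl }) p)
  (anyFun? a t {λ f → ∃ λ g → P [ f , g ]}
    (λ eq (g , p) → g , resp (λ { (inj₁ x) → eq x ; (inj₂ y) → refl }) p)
    λ f → anyFun? b t {λ g → P [ f , g ]}
      (λ eq → resp λ { (inj₁ x) → refl ; (inj₂ y) → eq y }) λ g → P? [ f , g ])

module _ (s t : Term) where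

  IsEmb : (Pos s → Pos t) → Set
  IsEmb f = (∀ x y → f x ≡ f y → x ≡ y) × (∀ x y → Adj s x y → Adj t (f x) (f y)) × (∀ x → vw t (f x) ≡ vw s x)

  isEmb? : ∀ f → Dec (IsEmb f)
  isEmb? f = allPos? s (λ x → allPos? s λ y → (f x ≟Pos f y) →-dec (x ≟Pos y))
       ×-dec allPos? s (λ x → allPos? s λ y → adj? s x y →-dec adj? t (f x) (f y))
       ×-dec allPos? s (λ x → vw t (f x) ≟ vw s x)

  isEmb-resp : ∀ {f g} → f ≗ g → IsEmb f → IsEmb g
  isEmb-resp eq (i , a , w) =
    (λ x y p → i x y (trans (eq x) (trans p (sym (eq y))))) ,
    (λ x y p → subst₂ (Adj t) (eq x) (eq y) (a x y p)) ,
    (λ x → trans (cong (vw t) (sym (eq x))) (w x))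

  toEmb : ∀ {f} → IsEmb f → Emb (G t) s
  toEmb {f} (i , a , w) = record { emb = f ; inj = λ {x} {y} → i x y ; adj = λ {x} {y} → a x y ; weights = w }

  fromEmb : (E : Emb (G t) s) → IsEmb (emb E)
  fromEmb E = (λ x y → emb-inj E) , (λ x y → emb-adj E) , emb-weights E

  closedEmb? : Dec (ClosedEmb (G t) s)
  closedEmb? = map′
    (λ (f , e , c) → record { base = toEmb e ; closed = λ {x} ne {y} → c x y ne })
    (λ C → emb (base C) , fromEmb (base C) , λ x y ne → closed C ne)
    (anyFun? s t {λ f → IsEmb f × Closed f}
      (λ eq (e , c) → isEmb-resp eq e , λ x y ne p →
         let (z , q) = c x y ne (subst (λ u → Adj t u y) (sym (eq x)) p) in z , trans (sym (eq z)) q)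
      λ f → isEmb? f ×-dec allPos? s λ x → allPos? t λ y → ¬? (x ≟Pos root s) →-dec (adj? t (f x) y →-dec
              anyPos? s λ z → f z ≟Pos y))
    where
    Closed : (Pos s → Pos t) → Set
    Closed f = ∀ x y → x ≢ root s → Adj t (f x) y → ∃ λ z → f z ≡ y

  private
    Onto : (Pos s → Pos t) → Set
    Onto f = ∀ y → ∃ λ x → f x ≡ y

    onto? : ∀ f → Dec (Onto f)
    onto? f = allPos? t λ y → anyPos? s λ x → f x ≟Pos y

    onto-resp : ∀ {f g} → f ≗ g → Onto f → Onto g
    onto-resp eq o y = let (x , p) = o y in x , trans (sym (eq x)) p

    isoEmb : Iso (G s) (G t) → Emb (G t) s
    isoEmb f = record { emb = Iso.to f ; inj = Iso.to-inj f ; adj = Iso.adj f ; weights = Iso.weights f }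

  iso? : Dec (Iso (G s) (G t))
  iso? = map′
    (λ (f , e , o) → spanning (G-isTree t) (toEmb e) o)
    (λ f → Iso.to f , fromEmb (isoEmb f) , λ y → Iso.from f y , Iso.to-from f y)
    (anyFun? s t (λ eq (e , o) → isEmb-resp eq e , onto-resp eq o) λ f → isEmb? f ×-dec onto? f)

  tiso? : Dec (TIso s t)
  tiso? = map′
    (λ (f , e , o , r) → spanning (G-isTree t) (toEmb e) o ,ʳ r)
    (λ (f ,ʳ r) → Iso.to f , fromEmb (isoEmb f) , (λ y → Iso.from f y , Iso.to-from f y) , r)
    (anyFun? s t (λ eq (e , o , r) → isEmb-resp eq e , onto-resp eq o , trans (sym (eq (root s))) r)
      λ f → isEmb? f ×-dec onto? f ×-dec (f (root s) ≟Pos root t))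

_~~?_ : ∀ s t → Dec (s ~~ t)
s ~~? t = map′ (TIso⇒~~ s t) ~~⇒TIso (tiso? s t)

closedEmb-iso : ∀ {G H t} → Iso G H → ClosedEmb G t → ClosedEmb H t
closedEmb-iso {G} {H} f C = record
  { base = record
    { emb = Iso.to f ∘ emb (base C) ; inj = λ p → emb-inj (base C) (Iso.to-inj f p)
    ; adj = λ p → Iso.adj f (emb-adj (base C) p)
    ; weights = λ x → trans (Iso.weights f _) (emb-weights (base C) x) }
  ; closed = λ ne {y} e →
      let (z , p) = closed C ne (subst (λ u → WGraph._~_ G u (Iso.from f y)) (Iso.from-to f _) (Iso.adj (iso-sym f) e))
      in z , trans (cong (Iso.to f) p) (Iso.to-from f y) }

-- Enumeration of terms up to isomorphism

1≤wt : ∀ t → 1 ≤ wt t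
1≤wt (vert _)    = s≤s z≤n
1≤wt (graft a b) = ≤-trans (1≤wt a) (m≤m+n _ _)

-- Contains every term of weight at most d, and further terms.
termsTo : ℕ → List Term
termsTo zero    = []
termsTo (suc d) = map vert (upTo (suc d)) ++ cartesianProductWith graft (termsTo d) (termsTo d)

∈-termsTo : ∀ t d → wt t ≤ d → t ∈ˡ termsTo d
∈-termsTo t zero le = contradiction (≤-trans (1≤wt t) le) λ ()
∈-termsTo (vert k) (suc d) le = ∈-++⁺ˡ (∈-map⁺ vert (∈-upTo⁺ le))
∈-termsTo (graft a b) (suc d) le = ∈-++⁺ʳ (map vert (upTo (suc d))) (∈-cartesianProductWith⁺ graft
  (∈-termsTo a d (s≤s⁻¹ (≤-trans (≤-reflexive (+-comm 1 _)) (≤-trans (+-monoʳ-≤ (wt a) (1≤wt b)) le))))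
  (∈-termsTo b d (s≤s⁻¹ (≤-trans (+-monoˡ-≤ (wt b) (1≤wt a)) le))))

module _ {A : Set} {R : A → A → Set} (R? : ∀ x y → Dec (R x y)) where

  nub : List A → List A
  nub [] = []
  nub (x ∷ xs) with any? (R? x) (nub xs)
  ... | yes _ = nub xs
  ... | no  _ = x ∷ nub xs

  nub-All : ∀ {P : A → Set} {xs} → All P xs → All P (nub xs)
  nub-All [] = []
  nub-All {xs = x ∷ xs} (p ∷ ps) with any? (R? x) (nub xs)
  ... | yes _ = nub-All ps
  ... | no  _ = p ∷ nub-All ps

  nub-complete : (∀ {x} → R x x) → ∀ {x xs} → x ∈ˡ xs → Any (R x) (nub xs)
  nub-complete rfl {x} {y ∷ xs} i with any? (R? y) (nub xs) | i
  ... | yes p | here refl = p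
  ... | yes _ | there j   = nub-complete rfl j
  ... | no  _ | here refl = here rfl
  ... | no  _ | there j   = there (nub-complete rfl j)

  nub-distinct : ∀ xs → AllPairs (λ x y → ¬ R x y) (nub xs)
  nub-distinct [] = []
  nub-distinct (x ∷ xs) with any? (R? x) (nub xs)
  ... | yes _ = nub-distinct xs
  ... | no ¬p = All.¬Any⇒All¬ _ ¬p ∷ nub-distinct xs

lookup-distinct : ∀ {A : Set} {R : A → A → Set} → (∀ {x y} → R x y → R y x) →
  ∀ {xs} → AllPairs (λ x y → ¬ R x y) xs → ∀ i j → R (lookup xs i) (lookup xs j) → i ≡ j
lookup-distinct sy (_ ∷ _)  zero    zero    r = refl
lookup-distinct sy (p ∷ _)  zero    (suc j) r = contradiction r (All.lookup p (∈-lookup j))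
lookup-distinct sy (p ∷ _)  (suc i) zero    r = contradiction (sy r) (All.lookup p (∈-lookup i))
lookup-distinct sy (_ ∷ ps) (suc i) (suc j) r = cong suc (lookup-distinct sy ps i j r)

abstract
  reps : ℕ → List Term
  reps n = nub iso? (filter (λ t → wt t ≟ n) (termsTo n))

  reps-weight : ∀ n → All (λ t → wt t ≡ n) (reps n)
  reps-weight n = nub-All iso? (All.all-filter (λ t → wt t ≟ n) (termsTo n))

  reps-distinct : ∀ n → AllPairs (λ s t → ¬ Iso (G s) (G t)) (reps n)
  reps-distinct n = nub-distinct iso? (filter (λ t → wt t ≟ n) (termsTo n))

  reps-complete : ∀ t → Any (λ r → Iso (G t) (G r)) (reps (wt t))
  reps-complete t = nub-complete iso? iso-refl (∈-filter⁺ (λ s → wt s ≟ wt t) (∈-termsTo t (wt t) ≤-refl) refl)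

module _ (T : WeightedTree) where
  open WeightedTree T

  termOf : Term
  termOf = proj₁ (toTerm T (IsTree.nonempty isTree))

  termOf-iso : Iso (G termOf) graph
  termOf-iso = proj₁ (proj₂ (toTerm T (IsTree.nonempty isTree)))

  termOf-weight : wt termOf ≡ totalWeight
  termOf-weight = trans (sym (totalWeight-toWT termOf))
    (totalWeight-iso (toWT termOf) T (iso-trans (iso-sym (finIso termOf)) termOf-iso))

countTerms : ∀ {P : WeightedTree → Set} xs → AllPairs (λ s t → ¬ Iso (G s) (G t)) xs →
  (∀ {t} → t ∈ˡ xs → P (toWT t)) → (∀ T → P T → Any (λ t → Iso (G (termOf T)) (G t)) xs) →
  CountUpToIso P (length xs)
countTerms xs ne snd cmp = record
  { rep = λ i → toWT (lookup xs i)
  ; sound = λ i → snd (∈-lookup {xs = xs} i)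
  ; distinct = λ i j f → lookup-distinct iso-sym ne i j
      (iso-trans (finIso _) (iso-trans (≅⇒Iso f) (iso-sym (finIso _))))
  ; complete = λ T p → let q = cmp T p in
      Any.index q , Iso⇒≅ (iso-trans (iso-sym (termOf-iso T)) (iso-trans (AnyP.lookup-index q) (finIso _))) }

-- Trading pieces for markers

addw : ℕ → Term → Term
addw c (vert k)    = vert (c + k)
addw c (graft a b) = graft a (addw c b)

-- The union of s and t with their roots identified; the root weights k + 1 and l + 1 become k + l + 1.
fuse : Term → Term → Term
fuse (vert c)    t = addw c t
fuse (graft a s) t = graft a (fuse s t)

-- The trees `ks` are strung along a path through their roots, the head of the list on top, and `t`
-- hangs below the last of them.
hang : List Term → Term → Term
hang ks t = foldr (λ s u → graft u s) t ks

-- The contexts that are traded for markers.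
data Piece : Set where
  merge : Term → Piece
  wrap  : List Term → Piece

apply : Piece → Term → Term
apply (merge s) = fuse s
apply (wrap ks) = hang ks

extra : Piece → ℕ
extra (merge s) = pred (wt s)
extra (wrap ks) = sum (map wt ks)

wt-addw : ∀ c t → wt (addw c t) ≡ c + wt t
wt-addw c (vert k)    = sym (+-suc c k)
wt-addw c (graft a b) = trans (cong (wt a +_) (wt-addw c b)) (lem (wt a) c (wt b))
  where lem : ∀ a c b → a + (c + b) ≡ c + (a + b)
        lem = solve-∀

suc-wt-fuse : ∀ s t → suc (wt (fuse s t)) ≡ wt s + wt t
suc-wt-fuse (vert c)    t = cong suc (wt-addw c t)
suc-wt-fuse (graft a s) t = trans (sym (+-suc (wt a) _)) (trans (cong (wt a +_) (suc-wt-fuse s t)) (sym (+-assoc (wt a) _ _)))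

wt-apply : ∀ p t → wt (apply p t) ≡ extra p + wt t
wt-apply (merge s) t with wt s | 1≤wt s | suc-wt-fuse s t
... | suc n | _ | eq = suc-injective eq
wt-apply (wrap [])       t = refl
wt-apply (wrap (s ∷ ks)) t = trans (cong (_+ wt s) (wt-apply (wrap ks) t)) (lem (sum (map wt ks)) (wt t) (wt s))
  where lem : ∀ x y z → x + y + z ≡ z + x + y
        lem = solve-∀

addw-cong : ∀ c {s t} → s ~~ t → addw c s ~~ addw c t
addw-cong c ~~-refl        = ~~-refl
addw-cong c (~~-sym p)     = ~~-sym (addw-cong c p)
addw-cong c (~~-trans p q) = ~~-trans (addw-cong c p) (addw-cong c q)
addw-cong c (~~-graft p q) = ~~-graft p (addw-cong c q)
addw-cong c ~~-swap        = ~~-swap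

apply-cong : ∀ p {s t} → s ~~ t → apply p s ~~ apply p t
apply-cong (merge (vert c))    eq = addw-cong c eq
apply-cong (merge (graft a s)) eq = ~~-graft ~~-refl (apply-cong (merge s) eq)
apply-cong (wrap [])           eq = eq
apply-cong (wrap (s ∷ ks))     eq = ~~-graft (apply-cong (wrap ks) eq) ~~-refl

fuse-graft : ∀ s a t → fuse s (graft a t) ~~ graft a (fuse s t)
fuse-graft (vert c)    a t = ~~-refl
fuse-graft (graft b s) a t = ~~-trans (~~-graft ~~-refl (fuse-graft s a t)) ~~-swap

addw-addw : ∀ c d t → addw c (addw d t) ≡ addw (c + d) t
addw-addw c d (vert k)    = cong vert (sym (+-assoc c d k))
addw-addw c d (graft a b) = cong (graft a) (addw-addw c d b)

fuse-assoc : ∀ s s′ t → fuse (fuse s s′) t ≡ fuse s (fuse s′ t)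
fuse-assoc (vert c)    (vert d)     t = sym (addw-addw c d t)
fuse-assoc (vert c)    (graft a s′) t = cong (graft a) (fuse-assoc (vert c) s′ t)
fuse-assoc (graft a s) s′           t = cong (graft a) (fuse-assoc s s′ t)

addw-fuse : ∀ c s t → addw c (fuse s t) ≡ fuse s (addw c t)
addw-fuse c (vert d)    t = trans (addw-addw c d t) (trans (cong (λ x → addw x t) (+-comm c d)) (sym (addw-addw d c t)))
addw-fuse c (graft a s) t = cong (graft a) (addw-fuse c s t)

wt-cong : ∀ {s t} → s ~~ t → wt s ≡ wt t
wt-cong ~~-refl        = refl
wt-cong (~~-sym p)     = sym (wt-cong p)
wt-cong (~~-trans p q) = trans (wt-cong p) (wt-cong q)
wt-cong (~~-graft p q) = cong₂ _+_ (wt-cong p) (wt-cong q)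
wt-cong (~~-swap {a} {b} {t}) = lem (wt a) (wt b) (wt t)
  where lem : ∀ x y z → x + (y + z) ≡ y + (x + z)
        lem = solve-∀

-- One less than the weight of the root: an isomorphism invariant that tells the two markers apart.
rootWeight : Term → ℕ
rootWeight (vert k)    = k
rootWeight (graft a b) = rootWeight b

rootWeight-cong : ∀ {s t} → s ~~ t → rootWeight s ≡ rootWeight t
rootWeight-cong ~~-refl        = refl
rootWeight-cong (~~-sym p)     = sym (rootWeight-cong p)
rootWeight-cong (~~-trans p q) = trans (rootWeight-cong p) (rootWeight-cong q)
rootWeight-cong (~~-graft p q) = rootWeight-cong q
rootWeight-cong ~~-swap        = refl

δ : Bool → Bool → ℕ
δ false false = 1
δ true  true  = 1
δ _     _     = 0

-- Encoding by markers and decoding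

module Encoding (ℓ : Term) (p : Piece) (k : ℕ) (extra≡ : extra p ≡ 2 + k + wt ℓ) where

  -- In both, the vertices outside `ℓ` fill up the weight to `extra p`, so that a trade preserves
  -- the total weight. The second marker has two vertices besides `ℓ`, each of weight at least one,
  -- whence the 2 in `extra≡`.
  marker : Bool → Term
  marker false = graft ℓ (vert (suc k))
  marker true  = graft (graft ℓ (vert 0)) (vert k)

  wt-marker : ∀ b → wt (marker b) ≡ extra p
  wt-marker false = trans (+-comm (wt ℓ) _) (sym extra≡)
  wt-marker true  = trans (lem (wt ℓ) k) (sym extra≡)
    where lem : ∀ l k → l + 1 + (1 + k) ≡ 2 + k + l
          lem = solve-∀

  classify : Term → Maybe Bool
  classify a with a ~~? marker false | a ~~? marker true
  ... | yes _ | _     = just false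
  ... | no _  | yes _ = just true
  ... | no _  | no _  = nothing

  classify-none : ∀ {a} → (∀ b → ¬ a ~~ marker b) → classify a ≡ nothing
  classify-none {a} ne with a ~~? marker false | a ~~? marker true
  ... | yes p | _     = contradiction p (ne false)
  ... | no _  | yes p = contradiction p (ne true)
  ... | no _  | no _  = refl

  classify-some : ∀ {a} b → a ~~ marker b → classify a ≡ just b
  classify-some {a} b eq with a ~~? marker false | a ~~? marker true
  classify-some false eq | yes _ | _     = refl
  classify-some true  eq | yes p | _     = contradiction (rootWeight-cong (~~-trans (~~-sym p) eq)) 1+n≢n
  classify-some false eq | no ne | _     = contradiction eq ne
  classify-some true  eq | no _  | yes _ = refl
  classify-some true  eq | no _  | no ne = contradiction eq ne

  classify-sound : ∀ {a} b → classify a ≡ just b → a ~~ marker b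
  classify-sound {a} b eq with a ~~? marker false | a ~~? marker true | eq
  ... | yes p | _     | refl = p
  ... | no _  | yes p | refl = p

  classify-cong : ∀ {a a′} → a ~~ a′ → classify a ≡ classify a′
  classify-cong {a} {a′} eq with classify a in q
  ... | just b = sym (classify-some b (~~-trans (~~-sym eq) (classify-sound b q)))
  ... | nothing with classify a′ in q′
  ... | nothing = refl
  ... | just b = contradiction (trans (sym q) (classify-some b (~~-trans eq (classify-sound b q′)))) λ ()

  applyN : ℕ → Term → Term
  applyN zero    t = t
  applyN (suc n) t = apply p (applyN n t)

  applyN-cong : ∀ n {s t} → s ~~ t → applyN n s ~~ applyN n t
  applyN-cong zero    eq = eq
  applyN-cong (suc n) eq = apply-cong p (applyN-cong n eq)

  marks : Term → ℕ
  marks (vert _)    = 0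
  marks (graft a t) = maybe′ (λ _ → suc (marks t)) (marks t) (classify a)

  -- All markers of a vertex are stripped before any piece is applied there. Applying a `wrap` at
  -- the marker's place in the list of children would depend on their order and not respect
  -- `~~-swap`.
  core : Term → Term
  core (vert w)    = vert w
  core (graft a t) = maybe′ (λ _ → core t) (graft (applyN (marks a) (core a)) (core t)) (classify a)

  -- Every marker below a vertex is replaced by one application of the piece p to that vertex.
  decode : Term → Term
  decode t = applyN (marks t) (core t)

  count : Bool → Term → ℕ
  count c (vert _)    = 0
  count c (graft a t) = maybe′ (λ b → δ b c + count c t) (count c a + count c t) (classify a)

  marks-cong : ∀ {s t} → s ~~ t → marks s ≡ marks t
  marks-cong ~~-refl        = refl
  marks-cong (~~-sym p)     = sym (marks-cong p)
  marks-cong (~~-trans p q) = trans (marks-cong p) (marks-cong q)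
  marks-cong (~~-graft {a′ = a′} p q) rewrite classify-cong p | marks-cong q = refl
  marks-cong (~~-swap {a} {b}) with classify a | classify b
  ... | just _  | just _  = refl
  ... | just _  | nothing = refl
  ... | nothing | just _  = refl
  ... | nothing | nothing = refl

  core-cong : ∀ {s t} → s ~~ t → core s ~~ core t
  core-cong ~~-refl        = ~~-refl
  core-cong (~~-sym p)     = ~~-sym (core-cong p)
  core-cong (~~-trans p q) = ~~-trans (core-cong p) (core-cong q)
  core-cong (~~-graft {a} {a′} p q) rewrite classify-cong p | marks-cong p with classify a′
  ... | just _  = core-cong q
  ... | nothing = ~~-graft (applyN-cong (marks a′) (core-cong p)) (core-cong q)
  core-cong (~~-swap {a} {b}) with classify a | classify b
  ... | just _  | just _  = ~~-refl
  ... | just _  | nothing = ~~-refl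
  ... | nothing | just _  = ~~-refl
  ... | nothing | nothing = ~~-swap

  decode-cong : ∀ {s t} → s ~~ t → decode s ~~ decode t
  decode-cong {s} {t} eq = subst (λ n → decode s ~~ applyN n (core t)) (marks-cong eq) (applyN-cong (marks s) (core-cong eq))

  count-cong : ∀ c {s t} → s ~~ t → count c s ≡ count c t
  count-cong c ~~-refl        = refl
  count-cong c (~~-sym p)     = sym (count-cong c p)
  count-cong c (~~-trans p q) = trans (count-cong c p) (count-cong c q)
  count-cong c (~~-graft p q) rewrite classify-cong p | count-cong c p | count-cong c q = refl
  count-cong c (~~-swap {a} {b} {t}) with classify a | classify b
  ... | just x  | just y  = lem (δ x c) (δ y c) (count c t)
    where lem : ∀ x y z → x + (y + z) ≡ y + (x + z)
          lem = solve-∀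
  ... | just x  | nothing = lem (δ x c) (count c b) (count c t)
    where lem : ∀ x y z → x + (y + z) ≡ y + (x + z)
          lem = solve-∀
  ... | nothing | just y  = lem (count c a) (δ y c) (count c t)
    where lem : ∀ x y z → x + (y + z) ≡ y + (x + z)
          lem = solve-∀
  ... | nothing | nothing = lem (count c a) (count c b) (count c t)
    where lem : ∀ x y z → x + (y + z) ≡ y + (x + z)
          lem = solve-∀

  -- Enc t u n: u arises from t by trading occurrences p[e] for e with a marker child; n counts the
  -- markers used of either kind. Decoding inserts p at the marked vertex, so above an occurrence of a
  -- wrap piece its root must not be extended any further: EncRoot allows extending the root, Enc does not.
  mutual
    data EncRoot : Term → Term → (Bool → ℕ) → Set where
      vert  : ∀ {w} → EncRoot (vert w) (vert w) (λ _ → 0)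
      graft : ∀ {a a′ b b′ m n} → Enc a a′ m → EncRoot b b′ n → EncRoot (graft a b) (graft a′ b′) (λ c → m c + n c)
      conv  : ∀ {t t′ u n n′} → t ~~ t′ → n ≗ n′ → EncRoot t u n → EncRoot t′ u n′
      mark  : ∀ {s t u n} b → p ≡ merge s → EncRoot t u n → EncRoot (fuse s t) (graft (marker b) u) (λ c → δ b c + n c)

    data Enc : Term → Term → (Bool → ℕ) → Set where
      node  : ∀ {t u n} → EncRoot t u n → Enc t u n
      conv  : ∀ {t t′ u n n′} → t ~~ t′ → n ≗ n′ → Enc t u n → Enc t′ u n′
      mark  : ∀ {t u n} b → Enc t u n → Enc (apply p t) (graft (marker b) u) (λ c → δ b c + n c)

  mutual
    encRoot-wt : ∀ {t u n} → EncRoot t u n → wt u ≡ wt t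
    encRoot-wt vert            = refl
    encRoot-wt (graft e f)     = cong₂ _+_ (enc-wt e) (encRoot-wt f)
    encRoot-wt (conv eq _ e)   = trans (encRoot-wt e) (wt-cong eq)
    encRoot-wt (mark {t = t} b refl e) = trans (cong₂ _+_ (wt-marker b) (encRoot-wt e)) (sym (wt-apply p t))

    enc-wt : ∀ {t u n} → Enc t u n → wt u ≡ wt t
    enc-wt (node e)           = encRoot-wt e
    enc-wt (conv eq _ e)      = trans (enc-wt e) (wt-cong eq)
    enc-wt (mark {t} b e)     = trans (cong₂ _+_ (wt-marker b) (enc-wt e)) (sym (wt-apply p t))

  marked-big : ∀ b u → extra p < wt (graft (marker b) u)
  marked-big b u = ≤-trans (≤-reflexive (+-comm 1 _)) (+-mono-≤ (≤-reflexive (sym (wt-marker b))) (1≤wt u))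

  mutual
    -- Any trade leaves a vertex with a marker below it, and the subtree at this vertex already
    -- outweighs the marker.
    encRoot-big : ∀ {t u n} → EncRoot t u n → u ~~ t ⊎ extra p < wt u
    encRoot-big vert = inj₁ ~~-refl
    encRoot-big (graft {a′ = a′} {b′ = b′} e f) with enc-big e | encRoot-big f
    ... | inj₁ p | inj₁ q = inj₁ (~~-graft p q)
    ... | inj₂ p | _      = inj₂ (≤-trans p (m≤m+n _ _))
    ... | _      | inj₂ q = inj₂ (≤-trans q (m≤n+m _ (wt a′)))
    encRoot-big (conv eq _ e) = Sum.map (λ q → ~~-trans q eq) id (encRoot-big e)
    encRoot-big (mark {u = u} b _ _) = inj₂ (marked-big b u)

    enc-big : ∀ {t u n} → Enc t u n → u ~~ t ⊎ extra p < wt u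
    enc-big (node e)      = encRoot-big e
    enc-big (conv eq _ e) = Sum.map (λ q → ~~-trans q eq) id (enc-big e)
    enc-big (mark {u = u} b _) = inj₂ (marked-big b u)

  NoMark : Term → Set
  NoMark (vert _)    = ⊤
  NoMark (graft a t) = (∀ b → ¬ a ~~ marker b) × NoMark a × NoMark t

  NoMark-cong : ∀ {s t} → s ~~ t → (NoMark s → NoMark t) × (NoMark t → NoMark s)
  NoMark-cong ~~-refl    = id , id
  NoMark-cong (~~-sym p) = let (f , g) = NoMark-cong p in g , f
  NoMark-cong (~~-trans p q) = let (f , g) = NoMark-cong p ; (f′ , g′) = NoMark-cong q in f′ ∘ f , g ∘ g′
  NoMark-cong (~~-graft p q) = let (f , g) = NoMark-cong p ; (f′ , g′) = NoMark-cong q in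
    (λ (n , x , y) → (λ b r → n b (~~-trans p r)) , f x , f′ y) ,
    (λ (n , x , y) → (λ b r → n b (~~-trans (~~-sym p) r)) , g x , g′ y)
  NoMark-cong ~~-swap = (λ (n , x , m , y , z) → m , y , n , x , z) , (λ (n , x , m , y , z) → m , y , n , x , z)

  NoMark-addw : ∀ c t → NoMark (addw c t) → NoMark t
  NoMark-addw c (vert _)    _           = tt
  NoMark-addw c (graft a b) (n , x , y) = n , x , NoMark-addw c b y

  NoMark-apply : ∀ q t → NoMark (apply q t) → NoMark t
  NoMark-apply (merge (vert c))    t x           = NoMark-addw c t x
  NoMark-apply (merge (graft a s)) t (_ , _ , x) = NoMark-apply (merge s) t x
  NoMark-apply (wrap [])           t x           = x
  NoMark-apply (wrap (s ∷ ks))     t (_ , x , _) = NoMark-apply (wrap ks) t x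

  -- An untouched child is no marker because `a` is none; a child with a trade inside it is strictly
  -- heavier than every marker.
  unmarked-child : ∀ {a a′ n} → Enc a a′ n → (∀ b → ¬ a ~~ marker b) → classify a′ ≡ nothing
  unmarked-child e ne with enc-big e
  ... | inj₁ q   = classify-none λ b r → ne b (~~-trans (~~-sym q) r)
  ... | inj₂ big = classify-none λ b r → <⇒≢ big (sym (trans (wt-cong r) (wt-marker b)))

  mutual
    -- The third component serves the `graft` case: `decode` applies the pieces after the unmarked
    -- child has been put back, the induction hypothesis before. It holds because a marker at the
    -- root in `EncRoot` forces `p` to be a `merge`, and fusing commutes with adding a child; a
    -- `wrap` in general does not.
    decode-encRoot : ∀ {t u n} → EncRoot t u n → NoMark t →
      decode u ~~ t × (∀ c → count c u ≡ n c) ×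
      (∀ a x → applyN (marks u) (graft a x) ~~ graft a (applyN (marks u) x))
    decode-encRoot vert _ = ~~-refl , (λ _ → refl) , (λ a x → ~~-refl)
    decode-encRoot (graft {a′ = a′} e f) (ne , x , y)
      rewrite unmarked-child e ne
      with d , c ← decode-enc e x | d′ , c′ , comm ← decode-encRoot f y =
      ~~-trans (comm _ _) (~~-graft d d′) , (λ b → cong₂ _+_ (c b) (c′ b)) , comm
    decode-encRoot (conv eq n≗ e) x with d , c , comm ← decode-encRoot e (proj₂ (NoMark-cong eq) x) =
      ~~-trans d eq , (λ b → trans (c b) (n≗ b)) , comm
    decode-encRoot (mark {s} {t} b refl e) x
      rewrite classify-some b (~~-refl {marker b})
      with d , c , comm ← decode-encRoot e (NoMark-apply p t x) =
      apply-cong p d , (λ b′ → cong (δ b b′ +_) (c b′)) ,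
      λ a x → ~~-trans (apply-cong p (comm a x)) (fuse-graft s a _)

    decode-enc : ∀ {t u n} → Enc t u n → NoMark t → decode u ~~ t × (∀ c → count c u ≡ n c)
    decode-enc (node e) x = let (d , c , _) = decode-encRoot e x in d , c
    decode-enc (conv eq n≗ e) x with d , c ← decode-enc e (proj₂ (NoMark-cong eq) x) =
      ~~-trans d eq , λ b → trans (c b) (n≗ b)
    decode-enc (mark {t} b e) x
      rewrite classify-some b (~~-refl {marker b})
      with d , c ← decode-enc e (NoMark-apply p t x) =
      apply-cong p d , λ b′ → cong (δ b b′ +_) (c b′)

-- Decomposition of a tree into pieces

_≟T_ : DecidableEquality Term
vert k    ≟T vert l      = map′ (cong vert) (λ { refl → refl }) (k ≟ l)
vert k    ≟T graft a b   = no λ ()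
graft a b ≟T vert l      = no λ ()
graft a b ≟T graft a′ b′ = map′ (λ { (refl , refl) → refl }) (λ { refl → refl , refl }) ((a ≟T a′) ×-dec (b ≟T b′))

_≟P_ : DecidableEquality Piece
merge s  ≟P merge t   = map′ (cong merge) (λ { refl → refl }) (s ≟T t)
merge s  ≟P wrap ks   = no λ ()
wrap ks  ≟P merge s   = no λ ()
wrap ks  ≟P wrap ks′  = map′ (cong wrap) (λ { refl → refl }) (List.≡-dec _≟T_ ks ks′)

occ : Piece → List Piece → ℕ
occ p [] = 0
occ p (q ∷ ps) with p ≟P q
... | yes _ = suc (occ p ps)
... | no  _ = occ p ps

occ-++ : ∀ p ps qs → occ p (ps ++ qs) ≡ occ p ps + occ p qs
occ-++ p []       qs = refl
occ-++ p (q ∷ ps) qs with p ≟P q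
... | yes _ = cong suc (occ-++ p ps qs)
... | no  _ = occ-++ p ps qs

total : (Bool → ℕ) → ℕ
total f = f false + f true

pair : ℕ → ℕ → Bool → ℕ
pair x y false = x
pair x y true  = y

-- Greedy: the first side is filled up to its capacity `m`, and the second takes what is left.
split-total : ∀ m n x y → x + y ≤ m + n → ∃ λ f → ∃ λ g →
  total f ≤ m × total g ≤ n × (∀ c → f c + g c ≡ pair x y c)
split-total zero    n x y le = pair 0 0 , pair x y , z≤n , le , λ { false → refl ; true → refl }
split-total (suc m) n zero zero le = pair 0 0 , pair 0 0 , z≤n , z≤n , λ { false → refl ; true → refl }
split-total (suc m) n zero (suc y) le with f , g , p , q , r ← split-total m n zero y (s≤s⁻¹ le) =
  pair (f false) (suc (f true)) , g , ≤-trans (≤-reflexive (+-suc (f false) (f true))) (s≤s p) , q ,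
  λ { false → r false ; true → cong suc (r true) }
split-total (suc m) n (suc x) y le with f , g , p , q , r ← split-total m n x y (s≤s⁻¹ le) =
  pair (suc (f false)) (f true) , g , s≤s p , q , λ { false → cong suc (r false) ; true → r true }

module _ (ℓ : Term) (p : Piece) (k : ℕ) (eq : extra p ≡ 2 + k + wt ℓ) where
  open Encoding ℓ p k eq

  enc-refl : ∀ t → Enc t t (λ _ → 0)
  encRoot-refl : ∀ t → EncRoot t t (λ _ → 0)
  enc-refl t = node (encRoot-refl t)
  encRoot-refl (vert _)    = vert
  encRoot-refl (graft a b) = graft (enc-refl a) (encRoot-refl b)

  encRoot-addw : ∀ c {t u n} → EncRoot t u n → EncRoot (addw c t) (addw c u) n
  encRoot-addw c vert            = vert
  encRoot-addw c (graft e f)     = graft e (encRoot-addw c f)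
  encRoot-addw c (conv q n≗ e)   = conv (addw-cong c q) n≗ (encRoot-addw c e)
  encRoot-addw c (mark {s} {t} b refl e) =
    subst (λ t → EncRoot t _ _) (sym (addw-fuse c s t)) (mark b refl (encRoot-addw c e))

  encRoot-fuse : ∀ s {t u n} → EncRoot t u n → EncRoot (fuse s t) (fuse s u) n
  encRoot-fuse (vert c)    e = encRoot-addw c e
  encRoot-fuse (graft a s) e = graft (enc-refl a) (encRoot-fuse s e)

  enc-hang : ∀ ks {t u n} → Enc t u n → Enc (hang ks t) (hang ks u) n
  enc-hang []       e = e
  enc-hang (s ∷ ks) e = conv ~~-refl (λ _ → +-identityʳ _) (node (graft (enc-hang ks e) (encRoot-refl s)))

module Decomposition (ℓ : Term) where

  -- Every piece `p` is allowed because the pigeonhole principle selects a frequent one only after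
  -- `ps` is complete. The request `f` prescribes how many markers of each kind are to be placed.
  RootEncodable Encodable : Term → List Piece → Set
  RootEncodable t ps = ∀ p k eq f → total f ≤ occ p ps → ∃ λ u → Encoding.EncRoot ℓ p k eq t u f
  Encodable     t ps = ∀ p k eq f → total f ≤ occ p ps → ∃ λ u → Encoding.Enc     ℓ p k eq t u f

  nodeE : ∀ {t ps} → RootEncodable t ps → Encodable t ps
  nodeE C p k eq f le = let (u , e) = C p k eq f le in u , Encoding.node e

  convE : ∀ {t t′ ps} → t ~~ t′ → Encodable t ps → Encodable t′ ps
  convE q C p k eq f le = let (u , e) = C p k eq f le in u , Encoding.conv q (λ _ → refl) e

  vertE : ∀ w → RootEncodable (vert w) []
  vertE w p k eq f le = vert w , Encoding.conv ~~-refl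
    (λ { false → sym (m+n≡0⇒m≡0 (f false) (n≤0⇒n≡0 le)) ; true → sym (m+n≡0⇒n≡0 (f false) (n≤0⇒n≡0 le)) }) Encoding.vert

  graftE : ∀ {a b ps qs} → Encodable a ps → RootEncodable b qs → RootEncodable (graft a b) (ps ++ qs)
  graftE {ps = ps} {qs} A B p k eq f le
    with g , h , gle , hle , g+h ← split-total (occ p ps) (occ p qs) (f false) (f true) (≤-trans le (≤-reflexive (occ-++ p ps qs)))
    with u , e ← A p k eq g gle | v , e′ ← B p k eq h hle
    = graft u v , Encoding.conv ~~-refl (λ { false → g+h false ; true → g+h true }) (Encoding.graft e e′)

  merge-plain : ∀ s {t ps} → RootEncodable t ps → RootEncodable (fuse s t) ps
  merge-plain s C p k eq f le = let (u , e) = C p k eq f le in fuse s u , encRoot-fuse ℓ p k eq s e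

  wrap-plain : ∀ ks {t ps} → Encodable t ps → Encodable (hang ks t) ps
  wrap-plain ks C p k eq f le = let (u , e) = C p k eq f le in hang ks u , enc-hang ℓ p k eq ks e

  merge-piece : ∀ s {t ps} → RootEncodable t ps → RootEncodable (fuse s t) (merge s ∷ ps)
  merge-piece s {ps = ps} C p k eq f le with p ≟P merge s
  ... | no _ = merge-plain s {ps = ps} C p k eq f le
  ... | yes refl with f false in f₀ | f true in f₁
  ... | zero | zero = merge-plain s {ps = ps} C p k eq f (subst₂ (λ x y → x + y ≤ _) (sym f₀) (sym f₁) z≤n)
  -- The new occurrence is spent on one of the requested markers, of the kind `false` if any is
  -- wanted; the others are requested from `ps`.
  ... | suc x | y with u , e ← C p k eq (pair x y) (s≤s⁻¹ le) =
    _ , Encoding.conv ~~-refl (λ { false → sym f₀ ; true → sym f₁ }) (Encoding.mark false refl e)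
  ... | zero | suc y with u , e ← C p k eq (pair 0 y) (s≤s⁻¹ le) =
    _ , Encoding.conv ~~-refl (λ { false → sym f₀ ; true → sym f₁ }) (Encoding.mark true refl e)

  wrap-piece : ∀ ks {t ps} → Encodable t ps → Encodable (hang ks t) (wrap ks ∷ ps)
  wrap-piece ks {ps = ps} C p k eq f le with p ≟P wrap ks
  ... | no _ = wrap-plain ks {ps = ps} C p k eq f le
  ... | yes refl with f false in f₀ | f true in f₁
  ... | zero | zero = wrap-plain ks {ps = ps} C p k eq f (subst₂ (λ x y → x + y ≤ _) (sym f₀) (sym f₁) z≤n)
  ... | suc x | y with u , e ← C p k eq (pair x y) (s≤s⁻¹ le) =
    _ , Encoding.conv ~~-refl (λ { false → sym f₀ ; true → sym f₁ }) (Encoding.mark false e)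
  ... | zero | suc y with u , e ← C p k eq (pair 0 y) (s≤s⁻¹ le) =
    _ , Encoding.conv ~~-refl (λ { false → sym f₀ ; true → sym f₁ }) (Encoding.mark true e)

  module _ (h : ℕ) (1≤h : 1 ≤ h) where

    Small : Piece → Set
    Small p = h ≤ extra p × extra p ≤ h + h

    -- The weight not covered by pieces hangs on the root: s and ks are remainders too light to be a piece.
    -- The slack 4 h or 5 h per heavy subtree pays for the remainders given up where two of them meet.
    data RootForm (t : Term) : Set where
      light : wt t ≤ h → RootForm t
      chain : ∀ ks z s ps → t ~~ graft (hang ks z) s → sum (map wt ks) ≤ h → wt s ≤ h → Encodable z ps →
              All Small ps → wt z + 4 * h ≤ 8 * h * length ps → RootForm t
      full  : ∀ s x ps → t ~~ fuse s x → wt s ≤ h → RootEncodable x ps →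
              All Small ps → wt x + 5 * h ≤ 8 * h * length ps → RootForm t

    data NodeForm (t : Term) : Set where
      light : wt t ≤ h → NodeForm t
      heavy : ∀ ks z ps → t ~~ hang ks z → sum (map wt ks) ≤ h → Encodable z ps →
              All Small ps → wt z + 4 * h ≤ 8 * h * length ps → NodeForm t

    fuse-vert0 : ∀ s → fuse s (vert 0) ≡ s
    fuse-vert0 (vert c)    = cong vert (+-identityʳ c)
    fuse-vert0 (graft a s) = cong (graft a) (fuse-vert0 s)

    addw-0 : ∀ t → addw 0 t ≡ t
    addw-0 (vert k)    = refl
    addw-0 (graft a t) = cong (graft a) (addw-0 t)

    ~~-reflexive : ∀ {s t} → s ≡ t → s ~~ t
    ~~-reflexive refl = ~~-refl

    wt-hang : ∀ ks t → sum (map wt ks) ≤ h → wt (hang ks t) ≤ h + wt t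
    wt-hang ks t le = ≤-trans (≤-reflexive (wt-apply (wrap ks) t)) (+-monoˡ-≤ (wt t) le)

    wt-fuse : ∀ s t {x} → wt s ≤ x → wt (fuse s t) < x + wt t
    wt-fuse s t le = ≤-trans (≤-reflexive (suc-wt-fuse s t)) (+-monoˡ-≤ (wt t) le)

    -- The credit `8 * h` of the new piece is used up exactly: `2 * h` for `s`, `h` for the excess
    -- of `x` over its own credit, and `5 * h` for the slack in `full`.
    cut : ∀ {t} s x ps → t ~~ fuse s x → h < wt s → wt s ≤ h + h → RootEncodable x ps → All Small ps →
          wt x ≤ 8 * h * length ps + h → RootForm t
    -- `vert 0` is neutral for `fuse` and stands for an empty remainder; its weight is one, hence
    -- `1≤h`.
    cut s x ps eq lo hi C sm bound = full (vert 0) (fuse s x) (merge s ∷ ps)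
      (~~-trans eq (~~-reflexive (sym (addw-0 _)))) 1≤h
      (merge-piece s {ps = ps} C) (small ∷ sm) (begin
        wt (fuse s x) + 5 * h                            ≤⟨ +-monoˡ-≤ (5 * h) (<⇒≤ (wt-fuse s x hi)) ⟩
        h + h + wt x + 5 * h                          ≤⟨ +-monoˡ-≤ (5 * h) (+-monoʳ-≤ (h + h) bound) ⟩
        h + h + (8 * h * length ps + h) + 5 * h       ≡⟨ lem h (length ps) ⟩
        8 * h * suc (length ps)                       ∎)
      where
      open ≤-Reasoning
      lem : ∀ h n → h + h + (8 * h * n + h) + 5 * h ≡ 8 * h * (1 + n)
      lem = solve-∀
      pw : suc (pred (wt s)) ≡ wt s
      pw = suc-pred (wt s) ⦃ >-nonZero (1≤wt s) ⦄
      small : Small (merge s)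
      small = s≤s⁻¹ (≤-trans lo (≤-reflexive (sym pw))) , ≤-trans (n≤1+n _) (≤-trans (≤-reflexive pw) hi)

    sum-small : ∀ s′ s → wt s′ ≤ suc h → wt s ≤ h → wt (fuse s′ s) ≤ h + h
    sum-small s′ s p q = s≤s⁻¹ (≤-trans (wt-fuse s′ s p) (+-monoʳ-≤ (suc h) q))

    -- The root of `s′` is absorbed by `fuse`, which takes one off the weight. A remainder of weight
    -- at most `h` thus grows to at most `2 * h`: it either stays light or can be cut off as a
    -- `merge` piece.
    addLight : ∀ s′ t → wt s′ ≤ suc h → RootForm t → RootForm (fuse s′ t)
    addLight s′ t le (light l) with wt (fuse s′ t) ≤? h
    ... | yes l′ = light l′
    ... | no ¬l = cut (fuse s′ t) (vert 0) [] (~~-reflexive (sym (fuse-vert0 _))) (≰⇒> ¬l) (sum-small s′ t le l)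
                    (vertE 0) [] (≤-trans 1≤h (m≤n+m h (8 * h * 0)))
    addLight s′ t le (chain ks z s ps eq k≤ s≤ C sm bound) with wt (fuse s′ s) ≤? h
    ... | yes l′ = chain ks z (fuse s′ s) ps (~~-trans (apply-cong (merge s′) eq) (fuse-graft s′ _ s)) k≤ l′ C sm bound
    ... | no ¬l = cut (fuse s′ s) (graft (hang ks z) (vert 0)) ps
            (~~-trans (apply-cong (merge s′) eq) (~~-trans (fuse-graft s′ _ s)
              (~~-trans (~~-graft ~~-refl (~~-reflexive (sym (fuse-vert0 (fuse s′ s))))) (~~-sym (fuse-graft (fuse s′ s) _ _)))))
            (≰⇒> ¬l) (sum-small s′ s le s≤)
            (subst (RootEncodable _) (List.++-identityʳ ps) (graftE {ps = ps} {[]} (wrap-plain ks {ps = ps} C) (vertE 0)))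
            sm (begin
              wt (hang ks z) + 1           ≤⟨ +-mono-≤ (wt-hang ks z k≤) 1≤h ⟩
              h + wt z + h              ≤⟨ m≤m+n _ (3 * h) ⟩
              h + wt z + h + 3 * h      ≡⟨ lem h (wt z) ⟩
              wt z + 4 * h + h          ≤⟨ +-monoˡ-≤ h bound ⟩
              8 * h * length ps + h     ∎)
      where
      open ≤-Reasoning
      lem : ∀ h z → h + z + h + 3 * h ≡ z + 4 * h + h
      lem = solve-∀
    addLight s′ t le (full s x ps eq s≤ C sm bound) with wt (fuse s′ s) ≤? h
    ... | yes l′ = full (fuse s′ s) x ps t~~ l′ C sm bound
      where t~~ = ~~-trans (apply-cong (merge s′) eq) (~~-reflexive (sym (fuse-assoc s′ s x)))
    ... | no ¬l = cut (fuse s′ s) x ps (~~-trans (apply-cong (merge s′) eq) (~~-reflexive (sym (fuse-assoc s′ s x))))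
            (≰⇒> ¬l) (sum-small s′ s le s≤) C sm (≤-trans (m≤m+n _ _) (≤-trans bound (m≤m+n _ _)))

    -- A stretch with light side branches cannot pass a vertex with two heavy children, so path
    -- remainders are given up there. When the second heavy child arrives, the two slacks of `4 * h`
    -- pay for `ks`, for `ks′`, for a root of weight one, bounded by `h`, and for the new slack
    -- `5 * h`.
    addHeavy : ∀ {a t} ks z ps → a ~~ hang ks z → sum (map wt ks) ≤ h → Encodable z ps → All Small ps →
      wt z + 4 * h ≤ 8 * h * length ps → RootForm t → RootForm (graft a t)
    addHeavy {t = t} ks z ps eq k≤ C sm bound (light l) = chain ks z t ps (~~-graft eq ~~-refl) k≤ l C sm bound
    addHeavy ks z ps eq k≤ C sm bound (chain ks′ z′ s ps′ eq′ k≤′ s≤ C′ sm′ bound′) =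
      full s (graft Y (graft Y′ (vert 0))) (ps ++ ps′)
        (~~-trans (~~-graft eq eq′) (~~-sym (~~-trans (fuse-graft s _ _)
          (~~-graft ~~-refl (~~-trans (fuse-graft s _ _) (~~-graft ~~-refl (~~-reflexive (fuse-vert0 s))))))))
        s≤
        (graftE {ps = ps} {ps′} (wrap-plain ks {ps = ps} C)
          (subst (RootEncodable _) (List.++-identityʳ ps′) (graftE {ps = ps′} {[]} (wrap-plain ks′ {ps = ps′} C′) (vertE 0))))
        (All.++⁺ sm sm′) (begin
          wt Y + (wt Y′ + 1) + 5 * h             ≤⟨ +-monoˡ-≤ (5 * h) (+-mono-≤ (wt-hang ks z k≤) (+-mono-≤ (wt-hang ks′ z′ k≤′) 1≤h)) ⟩
          h + wt z + (h + wt z′ + h) + 5 * h     ≡⟨ lem h (wt z) (wt z′) ⟩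
          wt z + 4 * h + (wt z′ + 4 * h)         ≤⟨ +-mono-≤ bound bound′ ⟩
          8 * h * length ps + 8 * h * length ps′ ≡⟨ *-distribˡ-+ (8 * h) (length ps) (length ps′) ⟨
          8 * h * (length ps + length ps′)       ≡⟨ cong (8 * h *_) (List.length-++ ps) ⟨
          8 * h * length (ps ++ ps′)             ∎)
      where
      open ≤-Reasoning
      Y = hang ks z
      Y′ = hang ks′ z′
      lem : ∀ h z z′ → h + z + (h + z′ + h) + 5 * h ≡ z + 4 * h + (z′ + 4 * h)
      lem = solve-∀
    addHeavy ks z ps eq k≤ C sm bound (full s x ps′ eq′ s≤ C′ sm′ bound′) =
      full s (graft (hang ks z) x) (ps ++ ps′) (~~-trans (~~-graft eq eq′) (~~-sym (fuse-graft s _ x))) s≤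
        (graftE {ps = ps} {ps′} (wrap-plain ks {ps = ps} C) C′) (All.++⁺ sm sm′) (begin
          wt (hang ks z) + wt x + 5 * h             ≡⟨ +-assoc (wt (hang ks z)) (wt x) (5 * h) ⟩
          wt (hang ks z) + (wt x + 5 * h)           ≤⟨ +-mono-≤ (wt-hang ks z k≤) bound′ ⟩
          h + wt z + 8 * h * length ps′          ≤⟨ +-monoˡ-≤ (8 * h * length ps′) (m≤m+n (h + wt z) (3 * h)) ⟩
          h + wt z + 3 * h + 8 * h * length ps′  ≡⟨ lem h (wt z) (8 * h * length ps′) ⟩
          wt z + 4 * h + 8 * h * length ps′      ≤⟨ +-monoˡ-≤ (8 * h * length ps′) bound ⟩
          8 * h * length ps + 8 * h * length ps′ ≡⟨ *-distribˡ-+ (8 * h) (length ps) (length ps′) ⟨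
          8 * h * (length ps + length ps′)       ≡⟨ cong (8 * h *_) (List.length-++ ps) ⟨
          8 * h * length (ps ++ ps′)             ∎)
      where
      open ≤-Reasoning
      lem : ∀ h z y → h + z + 3 * h + y ≡ z + 4 * h + y
      lem = solve-∀

    -- Once the root receives no more children, its remainder can grow only along a path: `s` joins
    -- `ks`, and both together stay light or form a `wrap` piece of weight at most `2 * h`. In the
    -- case `full`, `s` is given up, paid for by the drop of the slack from `5 * h` to `4 * h`.
    asNode : ∀ {t} → RootForm t → NodeForm t
    asNode (light l) = light l
    asNode (chain ks z s ps eq k≤ s≤ C sm bound) with sum (map wt (s ∷ ks)) ≤? h
    ... | yes l = heavy (s ∷ ks) z ps eq l C sm bound
    ... | no ¬l = heavy [] (hang (s ∷ ks) z) (wrap (s ∷ ks) ∷ ps) eq z≤n (wrap-piece (s ∷ ks) {ps = ps} C)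
            ((<⇒≤ (≰⇒> ¬l) , +-mono-≤ s≤ k≤) ∷ sm) (begin
              wt (hang (s ∷ ks) z) + 4 * h            ≡⟨ cong (_+ 4 * h) (wt-apply (wrap (s ∷ ks)) z) ⟩
              extra (wrap (s ∷ ks)) + wt z + 4 * h ≡⟨ +-assoc (extra (wrap (s ∷ ks))) (wt z) (4 * h) ⟩
              extra (wrap (s ∷ ks)) + (wt z + 4 * h) ≤⟨ +-mono-≤ (+-mono-≤ s≤ k≤) bound ⟩
              h + h + 8 * h * length ps            ≤⟨ m≤m+n _ (6 * h) ⟩
              h + h + 8 * h * length ps + 6 * h    ≡⟨ lem h (length ps) ⟩
              8 * h * suc (length ps)              ∎)
      where
      open ≤-Reasoning
      lem : ∀ h n → h + h + 8 * h * n + 6 * h ≡ 8 * h * (1 + n)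
      lem = solve-∀
    asNode (full s x ps eq s≤ C sm bound) = heavy [] (fuse s x) ps eq z≤n (nodeE {ps = ps} (merge-plain s {ps = ps} C)) sm (begin
      wt (fuse s x) + 4 * h  ≤⟨ +-monoˡ-≤ (4 * h) (<⇒≤ (wt-fuse s x s≤)) ⟩
      h + wt x + 4 * h    ≡⟨ lem h (wt x) ⟩
      wt x + 5 * h        ≤⟨ bound ⟩
      8 * h * length ps   ∎)
      where
      open ≤-Reasoning
      lem : ∀ h x → h + x + 4 * h ≡ x + 5 * h
      lem = solve-∀

    -- The weight of a single vertex is added unit by unit, so that it can itself be divided into
    -- `merge` pieces. A light child `a` is added as `graft a (vert 0)`, whose own root accounts for
    -- the bound `suc h` in `addLight`.
    rootForm : ∀ t → RootForm t
    rootForm (vert zero)    = light 1≤h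
    rootForm (vert (suc k)) = addLight (vert 1) (vert k) (s≤s 1≤h) (rootForm (vert k))
    rootForm (graft a b) with asNode (rootForm a)
    ... | light l = subst (λ u → RootForm (graft a u)) (addw-0 b)
      (addLight (graft a (vert 0)) b (≤-trans (≤-reflexive (+-comm (wt a) 1)) (s≤s l)) (rootForm b))
    ... | heavy ks z ps eq k≤ C sm bound = addHeavy ks z ps eq k≤ C sm bound (rootForm b)

    decompose : ∀ t → h < wt t → ∃ λ ps → Encodable t ps × All Small ps × wt t ≤ 8 * h * length ps
    decompose t lo with asNode (rootForm t)
    ... | light l = contradiction l (<⇒≱ lo)
    ... | heavy ks z ps eq k≤ C sm bound = ps , convE {ps = ps} (~~-sym eq) (wrap-plain ks {ps = ps} C) , sm , (begin
      wt t              ≡⟨ wt-cong eq ⟩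
      wt (hang ks z)       ≤⟨ wt-hang ks z k≤ ⟩
      h + wt z          ≡⟨ +-comm h (wt z) ⟩
      wt z + h          ≤⟨ +-monoʳ-≤ (wt z) (m≤n*m h 4) ⟩
      wt z + 4 * h      ≤⟨ bound ⟩
      8 * h * length ps ∎)
      where open ≤-Reasoning

-- Avoiding the limb makes the encoding injective

module _ (ℓ : Term) where

  -- Such copies of ℓ persist when t becomes part of a larger tree.
  InnerLimb : Term → Set
  InnerLimb t = Σ (ClosedEmb (G t) ℓ) λ C → ∀ x → emb (base C) x ≢ root t

  innerLimb-~~ : ∀ {s t} → s ~~ t → InnerLimb s → InnerLimb t
  innerLimb-~~ eq (C , avoids) with f ,ʳ r ← ~~⇒TIso eq =
    closedEmb-iso f C , λ x p → avoids x (Iso.to-inj f (trans p (sym r)))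

  innerLimb-left : ∀ {a b} → InnerLimb a → InnerLimb (graft a b)
  innerLimb-left {a} {b} (C , avoids) = record
    { base = record { emb = inj₁ ∘ emb (base C) ; inj = emb-inj (base C) ∘ inj₁-injective
                    ; adj = emb-adj (base C) ; weights = emb-weights (base C) }
    ; closed = λ {x} ne {y} → closed′ x ne y } , λ _ ()
    where
    closed′ : ∀ x → x ≢ root ℓ → ∀ y → Adj (graft a b) (inj₁ (emb (base C) x)) y → ∃ λ z → inj₁ (emb (base C) z) ≡ y
    closed′ x ne (inj₁ y) p = let (z , q) = closed C ne p in z , cong inj₁ q
    closed′ x ne (inj₂ y) (p , _) = contradiction p (avoids x)

  innerLimb-right : ∀ {a b} → InnerLimb b → InnerLimb (graft a b)
  innerLimb-right {a} {b} (C , avoids) = record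
    { base = record { emb = inj₂ ∘ emb (base C) ; inj = emb-inj (base C) ∘ inj₂-injective
                    ; adj = emb-adj (base C) ; weights = emb-weights (base C) }
    ; closed = λ {x} ne {y} → closed′ x ne y } , λ x p → avoids x (inj₂-injective p)
    where
    closed′ : ∀ x → x ≢ root ℓ → ∀ y → Adj (graft a b) (inj₂ (emb (base C) x)) y → ∃ λ z → inj₂ (emb (base C) z) ≡ y
    closed′ x ne (inj₂ y) p = let (z , q) = closed C ne p in z , cong inj₂ q
    closed′ x ne (inj₁ y) (_ , p) = contradiction p (avoids x)

  innerLimb-child : ∀ b → InnerLimb (graft ℓ b)
  innerLimb-child b = record
    { base = record { emb = inj₁ ; inj = inj₁-injective ; adj = id ; weights = λ _ → refl }
    ; closed = λ {x} ne {y} → closed′ x ne y } , λ _ ()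
    where
    closed′ : ∀ x → x ≢ root ℓ → ∀ y → Adj (graft ℓ b) (inj₁ x) y → ∃ λ z → inj₁ z ≡ y
    closed′ x ne (inj₁ y) p = y , refl
    closed′ x ne (inj₂ y) (p , _) = contradiction p ne

  module _ (p : Piece) (k : ℕ) (eq : extra p ≡ 2 + k + wt ℓ) where
    open Encoding ℓ p k eq

    innerLimb-marker : ∀ b → InnerLimb (marker b)
    innerLimb-marker false = innerLimb-child (vert (suc k))
    innerLimb-marker true  = innerLimb-left {b = vert k} (innerLimb-child (vert 0))

    -- A marker has `ℓ` as an inner limb, and such a copy persists in every tree in which the marker
    -- occurs as a child.
    avoiding⇒NoMark : ∀ t → ¬ InnerLimb t → NoMark t
    avoiding⇒NoMark (vert _)    _  = tt
    avoiding⇒NoMark (graft a b) none =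
      (λ c eq → none (innerLimb-left {a} {b} (innerLimb-~~ (~~-sym eq) (innerLimb-marker c)))) ,
      avoiding⇒NoMark a (none ∘ innerLimb-left {a} {b}) , avoiding⇒NoMark b (none ∘ innerLimb-right {a} {b})

    -- `decode` recovers the tree, `count` recovers the numbers of markers, and both respect `~~`.
    enc-injective : ∀ {s t u v m n} → Enc s u m → Enc t v n → ¬ InnerLimb s → ¬ InnerLimb t → u ~~ v → s ~~ t × m ≗ n
    enc-injective {s} {t} e e′ ns nt eq
      with d , c ← decode-enc e (avoiding⇒NoMark s ns) | d′ , c′ ← decode-enc e′ (avoiding⇒NoMark t nt) =
      ~~-trans (~~-sym d) (~~-trans (decode-cong eq) d′) ,
      λ b → trans (sym (c b)) (trans (count-cong b eq) (c′ b))

-- Counting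

listsTo : ℕ → List (List Term)
listsTo zero    = [] ∷ []
listsTo (suc d) = [] ∷ cartesianProductWith _∷_ (termsTo (suc d)) (listsTo d)

∈-listsTo : ∀ ks d → sum (map wt ks) ≤ d → ks ∈ˡ listsTo d
∈-listsTo []       zero    le = here refl
∈-listsTo []       (suc d) le = here refl
∈-listsTo (s ∷ ks) zero    le = contradiction (≤-trans (1≤wt s) (≤-trans (m≤m+n _ _) le)) λ ()
∈-listsTo (s ∷ ks) (suc d) le = there (∈-cartesianProductWith⁺ _∷_
  (∈-termsTo s (suc d) (≤-trans (m≤m+n _ _) le))
  (∈-listsTo ks d (s≤s⁻¹ (≤-trans (+-monoˡ-≤ _ (1≤wt s)) le))))

piecesTo : ℕ → List Piece
piecesTo d = map merge (termsTo (suc d)) ++ map wrap (listsTo d)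

∈-piecesTo : ∀ p d → extra p ≤ d → p ∈ˡ piecesTo d
∈-piecesTo (merge s) d le = ∈-++⁺ˡ (∈-map⁺ merge (∈-termsTo s (suc d) (≤-trans (suc-pred-≤ (wt s)) (s≤s le))))
  where suc-pred-≤ : ∀ n → n ≤ suc (pred n)
        suc-pred-≤ zero    = z≤n
        suc-pred-≤ (suc n) = ≤-refl
∈-piecesTo (wrap ks) d le = ∈-++⁺ʳ (map merge (termsTo (suc d))) (∈-map⁺ wrap (∈-listsTo ks d le))

occ-mono : ∀ q ps p → occ p ps ≤ occ p (q ∷ ps)
occ-mono q ps p with p ≟P q
... | yes _ = n≤1+n _
... | no  _ = ≤-refl

sum-occ-mono : ∀ q ps Ts → sum (map (λ p → occ p ps) Ts) ≤ sum (map (λ p → occ p (q ∷ ps)) Ts)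
sum-occ-mono q ps []       = z≤n
sum-occ-mono q ps (p ∷ Ts) = +-mono-≤ (occ-mono q ps p) (sum-occ-mono q ps Ts)

sum-occ-∈ : ∀ {q} ps {Ts} → q ∈ˡ Ts → sum (map (λ p → occ p ps) Ts) < sum (map (λ p → occ p (q ∷ ps)) Ts)
sum-occ-∈ {q} ps {.q ∷ Ts} (here refl) with q ≟P q
... | yes _ = s≤s (+-monoʳ-≤ (occ q ps) (sum-occ-mono q ps Ts))
... | no ne = contradiction refl ne
sum-occ-∈ {q} ps {p ∷ Ts} (there i) = ≤-trans (≤-reflexive (sym (+-suc (occ p ps) _)))
  (+-mono-≤ (occ-mono q ps p) (sum-occ-∈ ps i))

-- Only an inequality, since `Ts` may list a piece more than once.
length≤sum-occ : ∀ {ps Ts} → All (_∈ˡ Ts) ps → length ps ≤ sum (map (λ p → occ p ps) Ts)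
length≤sum-occ []       = z≤n
length≤sum-occ {q ∷ ps} (i ∷ is) = ≤-trans (s≤s (length≤sum-occ is)) (sum-occ-∈ ps i)

large-summand : ∀ {A : Set} (f : A → ℕ) m xs → m * length xs < sum (map f xs) → ∃ λ x → x ∈ˡ xs × m < f x
large-summand f m []       lt = contradiction lt λ ()
large-summand f m (x ∷ xs) lt with m <? f x
... | yes p = x , here refl , p
... | no ¬p with y , i , q ← large-summand f m xs (+-cancelˡ-< m _ _ (≤-trans
                (≤-trans (≤-reflexive (cong suc (sym (*-suc m (length xs))))) lt) (+-monoˡ-≤ _ (≮⇒≥ ¬p))))
              = y , there i , q

pigeonhole : ∀ m {ps Ts} → All (_∈ˡ Ts) ps → m * length Ts < length ps → ∃ λ p → p ∈ˡ Ts × m < occ p ps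
pigeonhole m {ps} {Ts} is lt = large-summand (λ p → occ p ps) m Ts (≤-trans lt (length≤sum-occ is))

injection-bound : ∀ {a b c d e f} (F : Fin a → Fin b → Fin c → Fin d × Fin e × Fin f) →
  (∀ i x y i′ x′ y′ → F i x y ≡ F i′ x′ y′ → i ≡ i′ × x ≡ x′ × y ≡ y′) → a * (b * c) ≤ d * (e * f)
injection-bound {a} {b} {c} {d} {e} {f} F F-inj = Fin.injective⇒≤ {f = h} h-inj
  where
  pack : Fin d × Fin e × Fin f → Fin (d * (e * f))
  pack (u , v , w) = combine u (combine v w)
  pack-inj : ∀ s t → pack s ≡ pack t → s ≡ t
  pack-inj (u , v , w) (u′ , v′ , w′) eq with Fin.combine-injective u (combine v w) u′ (combine v′ w′) eq
  ... | refl , eq′ with Fin.combine-injective v w v′ w′ eq′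
  ... | refl , refl = refl
  h : Fin (a * (b * c)) → Fin (d * (e * f))
  h i = let (i₁ , j) = remQuot {a} (b * c) i ; (x , y) = remQuot {b} c j in pack (F i₁ x y)
  h-inj : ∀ {i i′} → h i ≡ h i′ → i ≡ i′
  h-inj {i} {i′} eq with p , q , r ← F-inj _ _ _ _ _ _ (pack-inj _ _ eq) =
    trans (sym (Fin.combine-remQuot {a} (b * c) i)) (trans (cong₂ combine p
      (trans (sym (Fin.combine-remQuot {b} c _)) (trans (cong₂ combine q r) (Fin.combine-remQuot {b} c _))))
      (Fin.combine-remQuot {a} (b * c) i′))

ord≤wt : ∀ t → ord t ≤ wt t
ord≤wt (vert k)    = s≤s z≤n
ord≤wt (graft a b) = +-mono-≤ (ord≤wt a) (ord≤wt b)

module Counting (ℓ : Term) where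

  hasLimb? : ∀ t → Dec (ClosedEmb (G t) ℓ)
  hasLimb? t = closedEmb? ℓ t

  avoiding : ℕ → List Term
  avoiding n = filter (¬? ∘ hasLimb?) (reps n)

  -- Markers of either kind are larger than ℓ, hence so must be the pieces traded for them.
  h : ℕ
  h = 2 + wt ℓ

  abstract
    pieces : List Piece
    pieces = filter (λ p → h ≤? extra p) (piecesTo (h + h))

    ∈-pieces⁺ : ∀ {p} → h ≤ extra p × extra p ≤ h + h → p ∈ˡ pieces
    ∈-pieces⁺ {p} (lo , hi) = ∈-filter⁺ (λ p → h ≤? extra p) (∈-piecesTo p (h + h) hi) lo

    ∈-pieces⁻ : ∀ {p} → p ∈ˡ pieces → h ≤ extra p
    ∈-pieces⁻ i = proj₂ (∈-filter⁻ (λ p → h ≤? extra p) {xs = piecesTo (h + h)} i)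

  record Coded (n : ℕ) (t : Term) (x y : ℕ) : Set where
    field
      {p}    : Piece
      p∈     : p ∈ˡ pieces
      {k}    : ℕ
      extra≡ : extra p ≡ 2 + k + wt ℓ
      {u}    : Term
      enc    : Encoding.Enc ℓ p k extra≡ t u (pair x y)
      r      : Fin (length (reps n))
      class  : Iso (G u) (G (lookup (reps n) r))

  module _ {n : ℕ} where

    ord≤n : ∀ r → ord (lookup (reps n) r) ≤ n
    ord≤n r = ≤-trans (ord≤wt (lookup (reps n) r)) (≤-reflexive (All.lookup (reps-weight n) (∈-lookup {xs = reps n} r)))

    -- A representative of the class of `u` and the vertex corresponding to its root fix `u` up to
    -- `~~`. The factor `Fin n` is the price of forgetting the root.
    code : ∀ {t x y} → Coded n t x y → Fin (length pieces) × Fin (length (reps n)) × Fin n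
    code c = Any.index p∈ , r , inject≤ (toFin (Iso.to class (root u))) (ord≤n r)
      where open Coded c

    code-injective : ∀ {t t′ x y x′ y′} (c : Coded n t x y) (c′ : Coded n t′ x′ y′) →
      ¬ ClosedEmb (G t) ℓ → ¬ ClosedEmb (G t′) ℓ → code c ≡ code c′ → t ~~ t′ × x ≡ x′ × y ≡ y′
    code-injective
      record { p = p ; p∈ = p∈ ; k = k ; extra≡ = eq ; u = u ; enc = e ; r = r ; class = f }
      record { p = p′ ; p∈ = p∈′ ; k = k′ ; extra≡ = eq′ ; u = u′ ; enc = e′ ; r = r′ ; class = f′ } nt nt′ same
      -- `Encoding` has the proof `extra≡` among its parameters, so `p`, `k` and that proof are all
      -- identified before the two encodings belong to one instance.
      with refl ← trans (AnyP.lookup-index p∈) (trans (cong (lookup pieces ∘ proj₁) same) (sym (AnyP.lookup-index p∈′)))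
      with refl ← +-cancelˡ-≡ 2 k k′ (+-cancelʳ-≡ (wt ℓ) (2 + k) (2 + k′) (trans (sym eq) eq′))
      with refl ← ≡-irrelevant eq eq′
      with refl ← cong (proj₁ ∘ proj₂) same
      -- Both roots correspond to the same vertex of the common representative, so the isomorphism
      -- through it preserves roots.
      with s , m ← enc-injective ℓ p k eq e e′ (nt ∘ proj₁) (nt′ ∘ proj₁)
             (TIso⇒~~ u u′ (iso-trans f (iso-sym f′) ,ʳ
               trans (cong (Iso.from f′) (Iso.to-inj (finIso (lookup (reps n) r))
                       (Fin.inject≤-injective _ _ _ _ (cong (proj₂ ∘ proj₂) same)))) (Iso.from-to f′ _)))
      = s , m false , m true

  -- Since `n` is at most `8 * h * length ps`, the hypothesis on `n` leaves more than
  -- `(M + M) * length pieces` pieces in the decomposition. One of them then occurs more than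
  -- `M + M` times, enough for any two numbers below `M`.
  encode : ∀ {n} M t → wt t ≡ n → h < n → 8 * h * (M + M) * length pieces < n →
    ∀ (x y : Fin M) → Coded n t (toℕ x) (toℕ y)
  encode M t refl h<n big x y
    with ps , C , sm , bound ← Decomposition.decompose ℓ h (s≤s z≤n) t h<n
    with p , p∈ , many ← pigeonhole (M + M) (All.map ∈-pieces⁺ sm)
           (*-cancelˡ-< (8 * h) _ _ (≤-trans (s≤s (≤-reflexive (sym (*-assoc (8 * h) (M + M) (length pieces))))) (≤-trans big bound)))
    = record { p∈ = p∈ ; extra≡ = extra≡ ; enc = proj₂ uenc ; r = Any.index found ; class = AnyP.lookup-index found }
    where
    h≤extra : h ≤ extra p
    h≤extra = ∈-pieces⁻ p∈
    extra≡ : extra p ≡ 2 + (extra p ∸ h) + wt ℓ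
    extra≡ = trans (sym (m+[n∸m]≡n h≤extra)) (cong (2 +_) (+-comm (wt ℓ) _))
    uenc = C p (extra p ∸ h) extra≡ (pair (toℕ x) (toℕ y))
      (≤-trans (+-mono-≤ (<⇒≤ (Fin.toℕ<n x)) (<⇒≤ (Fin.toℕ<n y))) (<⇒≤ many))
    found : Any (λ r → Iso (G (proj₁ uenc)) (G r)) (reps (wt t))
    found = subst (λ n → Any (λ r → Iso (G (proj₁ uenc)) (G r)) (reps n)) (Encoding.enc-wt ℓ p _ extra≡ (proj₂ uenc)) (reps-complete (proj₁ uenc))

  -- The representatives are pairwise non-isomorphic even as unrooted trees, so the relation `~~`
  -- obtained from `code-injective` already identifies their indices.
  avoiding-bound : ∀ n M → h < n → 8 * h * (M + M) * length pieces < n →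
    length (avoiding n) * (M * M) ≤ length pieces * (length (reps n) * n)
  avoiding-bound n M h<n big = injection-bound (λ i x y → code (coded i x y)) λ i x y i′ x′ y′ eq →
    let (s , p , q) = code-injective (coded i x y) (coded i′ x′ y′) (avoids i) (avoids i′) eq in
    lookup-distinct iso-sym (AllPairs.filter⁺ (¬? ∘ hasLimb?) (reps-distinct n)) i i′ (TIso.iso (~~⇒TIso s)) ,
    Fin.toℕ-injective p , Fin.toℕ-injective q
    where
    mem : ∀ i → lookup (avoiding n) i ∈ˡ reps n × ¬ ClosedEmb (G (lookup (avoiding n) i)) ℓ
    mem i = ∈-filter⁻ (¬? ∘ hasLimb?) {xs = reps n} (∈-lookup {xs = avoiding n} i)
    avoids = λ i → proj₂ (mem i)
    coded : ∀ i (x y : Fin M) → Coded n (lookup (avoiding n) i) (toℕ x) (toℕ y)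
    coded i = encode M _ (All.lookup (reps-weight n) (proj₁ (mem i))) h<n big

-- From the counting inequality to the limit

-- The value at all = 0 is junk.
proportionOf : ℕ → ℕ → ℚ
proportionOf f zero    = 0ℚ
proportionOf f (suc n) = ℤ.+ f ℚ./ suc n

proportionOf-nonZero : ∀ f n .⦃ _ : NonZero n ⦄ → proportionOf f n ≡ ℤ.+ f ℚ./ n
proportionOf-nonZero f (suc n) = refl

∣f-n∣ : ∀ f a n → f + a ≡ n → ℤ.∣ ℤ.+ f ℤ.* ℤ.+ 1 ℤ.+ ℤ.-[1+ 0 ] ℤ.* ℤ.+ n ∣ ≡ a
∣f-n∣ f a n refl = begin
  ℤ.∣ ℤ.+ f ℤ.* ℤ.+ 1 ℤ.+ ℤ.-[1+ 0 ] ℤ.* ℤ.+ (f + a) ∣ ≡⟨ cong ℤ.∣_∣ (cong₂ ℤ._+_ (ℤ.*-identityʳ (ℤ.+ f)) (ℤ.-1*i≡-i (ℤ.+ (f + a)))) ⟩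
  ℤ.∣ ℤ.+ f ℤ.+ ℤ.- (ℤ.+ (f + a)) ∣                     ≡⟨ cong ℤ.∣_∣ (ℤ.m-n≡m⊖n f (f + a)) ⟩
  ℤ.∣ f ℤ.⊖ (f + a) ∣                                  ≡⟨ ℤ.∣⊖∣-≤ (m≤m+n f a) ⟩
  f + a ∸ f                                            ≡⟨ m+n∸m≡n f a ⟩
  a                                                    ∎
  where open ≡-Reasoning

proportion-distance : ∀ f a n → f + a ≡ suc n → toℚᵘ ℚ.∣ proportionOf f (suc n) ℚ.- 1ℚ ∣ ℚᵘ.≃ mkℚᵘ (ℤ.+ a) n
proportion-distance f a n eq = begin-equality
  toℚᵘ ℚ.∣ p ℚ.- 1ℚ ∣              ≃⟨ ℚ.toℚᵘ-homo-∣-∣ (p ℚ.- 1ℚ) ⟩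
  ℚᵘ.∣ toℚᵘ (p ℚ.- 1ℚ) ∣           ≃⟨ ℚᵘ.∣-∣-cong (ℚ.toℚᵘ-homo-+ p (ℚ.- 1ℚ)) ⟩
  ℚᵘ.∣ toℚᵘ p ℚᵘ.- 1ℚᵘ ∣           ≃⟨ ℚᵘ.∣-∣-cong (ℚᵘ.+-congˡ (ℚᵘ.- 1ℚᵘ) (ℚ.toℚᵘ-fromℚᵘ (mkℚᵘ (ℤ.+ f) n))) ⟩
  ℚᵘ.∣ mkℚᵘ (ℤ.+ f) n ℚᵘ.- 1ℚᵘ ∣   ≃⟨ *≡* (cong₂ (λ x y → ℤ.+ x ℤ.* ℤ.+ y) (∣f-n∣ f a (suc n) eq) (sym (*-identityʳ (suc n)))) ⟩
  mkℚᵘ (ℤ.+ a) n                   ∎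
  where
  open ℚᵘ.≤-Reasoning
  p = proportionOf f (suc n)

⟶1 : ∀ (fav all avoid : ℕ → ℕ) → (∀ n → fav n + avoid n ≡ all n) →
  (∀ K → ∃ λ N → ∀ n → N ≤ n → 0 < all n × avoid n * K ≤ all n) →
  (λ n → proportionOf (fav n) (all n)) ⟶ 1ℚ
⟶1 fav all avoid split small (mkℚ ℤ.-[1+ _ ] _ _) (ℚ.*<* ())
⟶1 fav all avoid split small (mkℚ (ℤ.+ zero) _ _) (ℚ.*<* (ℤ.+<+ ()))
-- For `ε = (e + 1) / (d + 1)` it suffices that `avoid / all < 1 / (d + 1)`; the additional factor 2
-- makes the inequality strict.
⟶1 fav all avoid split small η@(mkℚ (ℤ.+ suc e) d _) _ with small (2 * suc d)
... | N , bound = N , close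
  where
  close : ∀ n → N ≤ n → ℚ.∣ proportionOf (fav n) (all n) ℚ.- 1ℚ ∣ ℚ.< η
  close n le with all n | split n | bound n le
  ... | suc m | eq | _ , b = ℚ.toℚᵘ-cancel-<
    (ℚᵘ.≤-<-trans (ℚᵘ.≤-reflexive (proportion-distance (fav n) (avoid n) m eq))
      (*<* (subst₂ ℤ._<_ (ℤ.pos-* (avoid n) (suc d)) (ℤ.pos-* (suc e) (suc m)) (ℤ.+<+ (begin-strict
        avoid n * suc d           <⟨ half (avoid n * suc d) (suc m) (s≤s z≤n) (≤-trans (≤-reflexive (double (avoid n) (suc d))) b) ⟩
        suc m                     ≤⟨ m≤m+n (suc m) (e * suc m) ⟩
        suc e * suc m             ∎)))))
    where
    open ≤-Reasoning
    double : ∀ a d → a * d + a * d ≡ a * (2 * d)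
    double a d = trans (sym (*-distribˡ-+ a d d)) (cong (λ x → a * (d + x)) (sym (+-identityʳ d)))
    half : ∀ x m → 0 < m → x + x ≤ m → x < m
    half zero    m 0<m _  = 0<m
    half (suc x) m _   le = ≤-trans (s≤s (≤-trans (m≤m+n (suc x) x) (≤-reflexive (+-comm (suc x) x)))) le

length-filter-¬ : ∀ {A : Set} {P : A → Set} (P? : ∀ x → Dec (P x)) xs →
  length (filter P? xs) + length (filter (¬? ∘ P?) xs) ≡ length xs
length-filter-¬ P? [] = refl
length-filter-¬ P? (x ∷ xs) with P? x
... | yes _ = cong suc (length-filter-¬ P? xs)
... | no  _ = trans (+-suc _ _) (cong suc (length-filter-¬ P? xs))

0<length-reps : ∀ n → 1 ≤ n → 0 < length (reps n)
0<length-reps (suc n) _ = nonempty (reps-complete (vert n))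
  where
  nonempty : ∀ {A : Set} {P : A → Set} {xs} → Any P xs → 0 < length xs
  nonempty (here _)  = s≤s z≤n
  nonempty (there _) = s≤s z≤n

-- With q = (n - 1) / B one has B q < n ≤ 2 B q, so that one factor q cancels.
quadratic-bound : ∀ (all avoid : ℕ → ℕ) c h b →
  (∀ n q → h < n → b * (q + q) * c < n → avoid n * (q * q) ≤ c * (all n * n)) →
  ∀ K → ∃ λ N → ∀ n → N ≤ n → avoid n * K ≤ all n
quadratic-bound all avoid c h b bound K = suc (D * suc K * B + h) , λ n le → go n le
  where
  -- This `B` gives `b * (q + q) * c ≤ q * B < n`, as `bound` requires. `D` collects the constants
  -- that remain after cancelling `q`, with `suc c` in place of `c` so that `D` can be cancelled
  -- too; asking for `q ≥ D * suc K` keeps `q` positive even for `K = 0`.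
  B = suc (b * 2 * c)
  D = 2 * suc c * B
  go : ∀ n → suc (D * suc K * B + h) ≤ n → avoid n * K ≤ all n
  go (suc m) (s≤s le) = *-cancelˡ-≤ D (begin
    D * (avoid n * K)           ≤⟨ *-monoʳ-≤ D (*-monoʳ-≤ (avoid n) (n≤1+n K)) ⟩
    D * (avoid n * suc K)       ≡⟨ lem₁ D (avoid n) (suc K) ⟩
    avoid n * (D * suc K)       ≤⟨ *-monoʳ-≤ (avoid n) q-large ⟩
    avoid n * q                 ≤⟨ *-cancelʳ-≤ (avoid n * q) (D * all n) q ⦃ >-nonZero q>0 ⦄ (begin
      avoid n * q * q           ≡⟨ *-assoc (avoid n) q q ⟩
      avoid n * (q * q)         ≤⟨ bound n q (s≤s (≤-trans (m≤n+m h _) le)) (s≤s (≤-trans small (m/n*n≤m m B))) ⟩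
      c * (all n * n)           ≤⟨ *-mono-≤ (n≤1+n c) (*-monoʳ-≤ (all n) n≤2qB) ⟩
      suc c * (all n * (q * B + q * B)) ≡⟨ lem₂ (suc c) (all n) q B ⟩
      D * all n * q             ∎) ⟩
    D * all n                   ∎)
    where
    open ≤-Reasoning
    n = suc m
    q = m / B
    lem₁ : ∀ x y z → x * (y * z) ≡ y * (x * z)
    lem₁ = solve-∀
    lem₂ : ∀ c a q B → c * (a * (q * B + q * B)) ≡ 2 * c * B * a * q
    lem₂ = solve-∀
    q-large : D * suc K ≤ q
    q-large = ≤-trans (≤-reflexive (sym (m*n/n≡m (D * suc K) B))) (/-monoˡ-≤ B (≤-trans (m≤m+n _ h) le))
    q>0 : 0 < q
    q>0 = ≤-trans (s≤s z≤n) q-large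
    small : b * (q + q) * c ≤ q * B
    small = ≤-trans (≤-reflexive (lem₃ b q c)) (*-monoʳ-≤ q (n≤1+n _))
      where lem₃ : ∀ b q c → b * (q + q) * c ≡ q * (b * 2 * c)
            lem₃ = solve-∀
    n≤2qB : n ≤ q * B + q * B
    n≤2qB = begin
      suc m                 ≡⟨ cong suc (m≡m%n+[m/n]*n m B) ⟩
      suc (m % B) + q * B   ≤⟨ +-monoˡ-≤ (q * B) (m%n<n m B) ⟩
      B + q * B             ≤⟨ +-monoˡ-≤ (q * B) (m≤n*m B q ⦃ >-nonZero q>0 ⦄) ⟩
      q * B + q * B         ∎

few-avoiding : ∀ ℓ K → ∃ λ N → ∀ n → N ≤ n →
  0 < length (reps n) × length (Counting.avoiding ℓ n) * K ≤ length (reps n)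
few-avoiding ℓ K =
  let (N , bound) = quadratic-bound (length ∘ reps) (length ∘ avoiding) (length pieces) h (8 * h) avoiding-bound K
  -- The shift by one ensures `n ≥ 1`, where the tree with a single vertex shows that there are
  -- trees at all.
  in suc N , λ n le → 0<length-reps n (≤-trans (s≤s z≤n) le) , bound n (≤-trans (n≤1+n N) le)
  where open Counting ℓ

-- The two counts and the theorem

module _ (L : WeightedRootedTree) where
  private
    ℓ = limbTerm L
  open Counting ℓ

  favourable : ℕ → List Term
  favourable n = filter hasLimb? (reps n)

  allTrees : ∀ n → CountUpToIso (λ T → WeightedTree.totalWeight T ≡ n) (length (reps n))
  allTrees n = countTerms (reps n) (reps-distinct n)
    (λ {t} i → trans (totalWeight-toWT t) (All.lookup (reps-weight n) i))
    λ T eq → subst (λ n → Any (λ t → Iso (G (termOf T)) (G t)) (reps n)) (trans (termOf-weight T) eq) (reps-complete (termOf T))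

  favourableTrees : ∀ n → CountUpToIso (λ T → WeightedTree.totalWeight T ≡ n × HasLimb T L) (length (favourable n))
  favourableTrees n = countTerms (favourable n) (AllPairs.filter⁺ hasLimb? (reps-distinct n))
    (λ {t} i → let (j , C) = ∈-filter⁻ hasLimb? {xs = reps n} i in
       trans (totalWeight-toWT t) (All.lookup (reps-weight n) j) ,
       ClosedEmb⇒HasLimb L (toWT t) (closedEmb-iso (finIso t) C))
    λ T (eq , hl) →
      let r , j , f = find (subst (λ n → Any (λ t → Iso (G (termOf T)) (G t)) (reps n)) (trans (termOf-weight T) eq) (reps-complete (termOf T)))
      in lose (∈-filter⁺ hasLimb? j (closedEmb-iso (iso-trans (iso-sym (termOf-iso T)) f) (HasLimb⇒ClosedEmb L T hl))) f

corollary3p1 : (L : WeightedRootedTree) →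
    Σ (ℕ → ℚ) λ proportion →
    (∀ n → 1 ≤ n → IsProportion n (λ T → HasLimb T L) (proportion n))
    × (proportion ⟶ 1ℚ)
corollary3p1 L = (λ n → proportionOf (length (favourable L n)) (length (reps n))) , isProportion ,
  ⟶1 (length ∘ favourable L) (length ∘ reps) (length ∘ avoiding) (λ n → length-filter-¬ hasLimb? (reps n)) (few-avoiding (limbTerm L))
  where
  open Counting (limbTerm L)
  isProportion : ∀ n → 1 ≤ n → IsProportion n (λ T → HasLimb T L) (proportionOf (length (favourable L n)) (length (reps n)))
  isProportion n le = record
    { all = length (reps n) ; favourable = length (favourable L n)
    ; allCount = allTrees L n ; favourCount = favourableTrees L n
    ; all-nonZero = nz ; ratio = proportionOf-nonZero _ _ ⦃ nz ⦄ }
    where nz = >-nonZero (0<length-reps n le)
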